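{- Let $p$ be an odd prime. Let $q=p^3$ and let $d$ be a (positive) divisor of $p^2+p+1$. If $d>p$, then $\omega(GP(q,d))=p$.
   Context: $\mathbb{F}_q$ is the finite field with $q$ elements and $\mathbb{F}_q^*=\mathbb{F}_q\setminus\{0\}$. For an integer $d>1$ and an odd prime power $q\equiv 1\pmod{2d}$ (this congruence holds automatically under the hypotheses of the claim), the $d$-Paley graph $GP(q,d)$ is the graph with vertex set $\mathbb{F}_q$ in which two vertices are adjacent if and only if their difference lies in $(\mathbb{F}_q^*)^d=\{x^d: x\in\mathbb{F}_q^*\}$. The clique number $\omega(X)$ of a graph $X$ is the maximum number of vertices of a complete subgraph of $X$. -}

module Defs where

open import Algebra.Apartness.Bundles using (HeytingCommutativeRing; HeytingField)
open import Algebra.Bundles using (CommutativeRing)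
import Algebra.Properties.Semiring.Exp as Exp
open import Data.Fin.Base using (Fin)
open import Data.Nat.Base using (ℕ; _≤_)
open import Data.Product.Base using (Σ-syntax; ∃-syntax; _×_)
open import Function.Bundles using (Inverse)
open import Function.Definitions using (Injective)
open import Level using (Level; _⊔_; suc)
open import Relation.Binary.Bundles using (Setoid)
open import Relation.Binary.Core using (Rel)
open import Relation.Binary.PropositionalEquality using (_≡_; _≢_)
  renaming (setoid to ≡-setoid)
open import Relation.Nullary.Negation.Core using (¬_)

private
  variable
    c ℓ ℓ₁ ℓ₂ a : Level

-- A graph is presented by its adjacency relation.  Symmetry is not a field:
-- `IsClique` below demands adjacency for both orders of every pair.
record Graph c ℓ a : Set (suc (c ⊔ ℓ ⊔ a)) where
  field
    vertices : Setoid c ℓ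
  open Setoid vertices public using () renaming (Carrier to Vertex; _≈_ to _≈ᵥ_)
  field
    Adjacent : Rel Vertex a

module _ (X : Graph c ℓ a) where
  open Graph X

  IsClique : ∀ {n} → (Fin n → Vertex) → Set (ℓ ⊔ a)
  IsClique f = Injective _≡_ _≈ᵥ_ f × (∀ {i j} → i ≢ j → Adjacent (f i) (f j))

  HasClique : ℕ → Set (c ⊔ ℓ ⊔ a)
  HasClique n = Σ[ f ∈ (Fin n → Vertex) ] IsClique f

  -- ω(X) = n
  CliqueNumberIs : ℕ → Set (c ⊔ ℓ ⊔ a)
  CliqueNumberIs n = HasClique n × (∀ m → HasClique m → m ≤ n)

module _ (F : HeytingField c ℓ₁ ℓ₂) where
  open HeytingField F

  open HeytingCommutativeRing heytingCommutativeRing using (commutativeRing)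
  open CommutativeRing commutativeRing using (semiring)
  open Exp semiring using (_^_)

  -- The enumeration makes _≈_ decidable, and with it invertibility, so a Heyting
  -- field with q elements is a field in the usual sense: x ≉ 0# implies x invertible.
  HasCardinality : ℕ → Set (c ⊔ ℓ₁)
  HasCardinality q = Inverse setoid (≡-setoid (Fin q))

  IsNonzeroPower : ℕ → Carrier → Set (c ⊔ ℓ₁)
  IsNonzeroPower d z = ∃[ x ] (¬ x ≈ 0# × z ≈ x ^ d)

  -- Adjacency is symmetric when F has q ≡ 1 (mod 2d) elements, as -1 is then a
  -- d-th power, and irreflexive since 0 is not a power of a nonzero element.
  PaleyGraph : ℕ → Graph c ℓ₁ (c ⊔ ℓ₁)
  PaleyGraph d = record
    { vertices = setoid
    ; Adjacent = λ u v → IsNonzeroPower d (u - v)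
    }

{-# OPTIONS --safe #-}
module Submission where

-- Write e = (p² + p + 1) / d; the hypotheses force e ≤ p − 2.
--
-- Upper bound.  Suppose a₀, …, aₚ is a clique.  A nonzero d-th power v satisfies
-- (vᵖ)ᵉ = vᵉ, so sᵢ = aᵢᵖ satisfies (sᵢ − sⱼ)ᵉ = (aᵢ − aⱼ)ᵉ for all i and j.  Take
-- e + 2 of the points and weights w annihilating all polynomials of degree ≤ e on the
-- aᵢ.  Then Σᵢ wᵢ (sᵢ − y)ᵉ has degree ≤ e in y and vanishes at all the sⱼ, hence is
-- zero; as e < p its binomial coefficients are invertible, and w also annihilates the
-- polynomials of degree ≤ e on the sᵢ.  Such a w is unique up to scaling, and comparing
-- the two descriptions of it for subsets of e + 3 points shows that a ↦ s preserves
-- cross ratios.  So with x = a₀ − a and t = s₀ − s = xᵖ, the quotient x / t = κ + γ x is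
-- affine in x, while it is always an e-th root of unity.  If γ ≠ 0 this gives p > e
-- distinct e-th roots of unity; if γ = 0 then xᵖ⁻¹ is constant on p distinct points.
--
-- Lower bound.  The prime field is a clique: its nonzero elements are (p − 1)-st roots of
-- unity, and all of those are (p² + p + 1)-st powers, since otherwise a polynomial of
-- degree (p² + p + 1)(p − 2) would vanish on all of F*.

open import Defs

open import Algebra.Apartness.Bundles using (HeytingCommutativeRing; HeytingField)
import Algebra.Apartness.Properties.HeytingCommutativeRing as HeytingCommutativeRingProperties
open import Algebra.Bundles using (CommutativeRing)
import Algebra.Properties.AbelianGroup as AbelianGroupProperties
import Algebra.Properties.CommutativeMonoid.Sum as CommutativeMonoidSum
import Algebra.Properties.CommutativeSemigroup as CommutativeSemigroupProperties
import Algebra.Properties.CommutativeSemiring.Binomial as Binomial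
import Algebra.Properties.CommutativeSemiring.Exp as Exp
import Algebra.Properties.Ring as RingProperties
import Algebra.Properties.Semiring.Mult as Mult
import Algebra.Properties.Semiring.Sum as Sum
import Algebra.Solver.CommutativeMonoid as CommutativeMonoidSolver
import Algebra.Solver.Ring.NaturalCoefficients.Default as Solver
open import Data.Empty using (⊥)
open import Data.Fin.Base using (Fin; zero; suc; toℕ; fromℕ; fromℕ<; inject₁; inject≤; punchIn)
open import Data.Fin.Patterns using (0F; 1F; 2F; 3F)
open import Data.Fin.Permutation using (Permutation; lift₀; permutation; transpose; _⟨$⟩ʳ_)
open import Data.Fin.Properties as Fin using (toℕ-fromℕ; toℕ-inject₁; toℕ<n)
open import Data.Fin.Relation.Unary.Top using (view; ‵fromℕ; ‵inject₁)
open import Data.Nat.Base as ℕ using (ℕ; zero; suc; z≤n; s≤s; s≤s⁻¹; _≤_; _<_; _∸_; _!)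
open import Data.Nat.Combinatorics using (_C_; nCn≡1; nCk≡nC[n∸k]; k![n∸k]!∣n!)
open import Data.Nat.Combinatorics.Specification using (nCk≡n!/k![n-k]!)
open import Data.Nat.Coprimality using (coprime-Bézout; prime⇒coprime)
open import Data.Nat.DivMod using (m*[n/m]≡n)
open import Data.Nat.Divisibility using (_∣_; _∣?_; divides; ∣1⇒≡1; ∣⇒≤; ∣m+n∣m⇒∣n)
open import Data.Nat.GCD using (module Bézout)
open import Data.Nat.Primality using (Prime; prime?; prime⇒nonZero; ¬prime[0]; ¬prime[1])
import Data.Nat.Properties as ℕ
open import Data.Nat.Solver using (module +-*-Solver)
open import Data.Product.Base using (∃; _×_; _,_; proj₁; proj₂)
open import Data.Vec.Functional using (Vector; head; tail; init; last; removeAt; replicate; _∷_)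
open import Function.Base using (_∘_)
open import Function.Bundles using (Injection; Inverse)
open import Function.Definitions using (Injective)
open import Function.Properties.Inverse using (↔⇒↣)
open import Level using (_⊔_)
open import Relation.Binary.Definitions using (Decidable; tri<; tri≈; tri>)
open import Relation.Binary.PropositionalEquality as ≡ using (_≡_; _≢_)
import Relation.Binary.Reasoning.Setoid as SetoidReasoning
open import Relation.Nullary.Decidable using (Dec; yes; no; from-no)
open import Relation.Nullary.Negation.Core using (¬_; contradiction)

-- Fields with decidable equality: inverses and cancellation.

record IsDiscreteField {c ℓ} (R : CommutativeRing c ℓ) : Set (c ⊔ ℓ) where
  open CommutativeRing R
  field
    _≟_     : Decidable _≈_
    1≉0     : ¬ 1# ≈ 0#
    inverse : ∀ x → ¬ x ≈ 0# → ∃ λ y → y * x ≈ 1#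

module Field {c ℓ} (R : CommutativeRing c ℓ) (isDiscreteField : IsDiscreteField R) where

  open CommutativeRing R hiding (zero)
  open IsDiscreteField isDiscreteField
  open AbelianGroupProperties +-abelianGroup
    using (∙-cancelˡ; ∙-cancelʳ; x∙y⁻¹≈ε⇒x≈y; x≈y⇒x∙y⁻¹≈ε; ⁻¹-injective; ⁻¹-anti-homo‿-)
  open RingProperties ring using (x[y-z]≈xy-xz; [y-z]x≈yx-zx)
  open CommutativeSemigroupProperties *-commutativeSemigroup
    using (x∙yz≈y∙xz; xy∙z≈xz∙y; interchange)
  open Exp commutativeSemiring
  open Sum semiring
  open Mult semiring renaming (_×_ to _·_)
  open Solver commutativeSemiring using (solve; _:*_; _:+_; _:=_; con)
  module CM = CommutativeMonoidSolver *-commutativeMonoid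
  open CM using (_⊕_; _⊜_)
  module Π = CommutativeMonoidSum *-commutativeMonoid
  open SetoidReasoning setoid

  -- The value at zero is a default. It keeps `inv` total, so that weights and slopes can be written
  -- down before their denominators are known to be nonzero.
  inv : Carrier → Carrier
  inv x with x ≟ 0#
  ... | yes _   = 0#
  ... | no  x≉0 = proj₁ (inverse x x≉0)

  inv-inverseˡ : ∀ {x} → ¬ x ≈ 0# → inv x * x ≈ 1#
  inv-inverseˡ {x} x≉0 with x ≟ 0#
  ... | yes x≈0  = contradiction x≈0 x≉0
  ... | no  x≉0′ = proj₂ (inverse x x≉0′)

  inv-inverseʳ : ∀ {x} → ¬ x ≈ 0# → x * inv x ≈ 1#
  inv-inverseʳ x≉0 = trans (*-comm _ _) (inv-inverseˡ x≉0)

  *-cancelˡ : ∀ {x y z} → ¬ x ≈ 0# → x * y ≈ x * z → y ≈ z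
  *-cancelˡ {x} {y} {z} x≉0 xy≈xz = begin
    y                  ≈⟨ expand y ⟩
    inv x * (x * y)    ≈⟨ *-congˡ xy≈xz ⟩
    inv x * (x * z)    ≈⟨ expand z ⟨
    z                  ∎
    where
    expand : ∀ y → y ≈ inv x * (x * y)
    expand y = begin
      y                 ≈⟨ *-identityˡ y ⟨
      1# * y            ≈⟨ *-congʳ (inv-inverseˡ x≉0) ⟨
      (inv x * x) * y   ≈⟨ *-assoc _ _ _ ⟩
      inv x * (x * y)   ∎

  xy≈0⇒y≈0 : ∀ {x y} → ¬ x ≈ 0# → x * y ≈ 0# → y ≈ 0#
  xy≈0⇒y≈0 {x} x≉0 xy≈0 = *-cancelˡ x≉0 (trans xy≈0 (sym (zeroʳ x)))

  *-≉0 : ∀ {x y} → ¬ x ≈ 0# → ¬ y ≈ 0# → ¬ x * y ≈ 0#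
  *-≉0 x≉0 y≉0 = y≉0 ∘ xy≈0⇒y≈0 x≉0

  ^-≉0 : ∀ {x} n → ¬ x ≈ 0# → ¬ x ^ n ≈ 0#
  ^-≉0 zero    x≉0 = 1≉0
  ^-≉0 (suc n) x≉0 = *-≉0 x≉0 (^-≉0 n x≉0)

  ∏-≉0 : ∀ {n} (t : Vector Carrier n) → (∀ i → ¬ t i ≈ 0#) → ¬ Π.sum t ≈ 0#
  ∏-≉0 {zero}  t t≉0 = 1≉0
  ∏-≉0 {suc n} t t≉0 = *-≉0 (t≉0 zero) (∏-≉0 (tail t) (t≉0 ∘ suc))

  inv-≉0 : ∀ {x} → ¬ x ≈ 0# → ¬ inv x ≈ 0#
  inv-≉0 {x} x≉0 x⁻¹≈0 = 1≉0 (begin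
    1#        ≈⟨ inv-inverseˡ x≉0 ⟨
    inv x * x ≈⟨ *-congʳ x⁻¹≈0 ⟩
    0# * x    ≈⟨ zeroˡ x ⟩
    0#        ∎)

  x≉y⇒x-y≉0 : ∀ {x y} → ¬ x ≈ y → ¬ x - y ≈ 0#
  x≉y⇒x-y≉0 x≉y = x≉y ∘ x∙y⁻¹≈ε⇒x≈y _ _

  [x-y]+y≈x : ∀ x y → (x - y) + y ≈ x
  [x-y]+y≈x x y = begin
    (x - y) + y   ≈⟨ +-assoc _ _ _ ⟩
    x + (- y + y) ≈⟨ +-congˡ (-‿inverseˡ y) ⟩
    x + 0#        ≈⟨ +-identityʳ x ⟩
    x             ∎

  1^n≈1 : ∀ n → 1# ^ n ≈ 1#
  1^n≈1 zero    = refl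
  1^n≈1 (suc n) = trans (*-identityˡ _) (1^n≈1 n)

  -- Weighted power sums and divided differences.

  private
    variable
      m n : ℕ

  -- Weights `w` on nodes `a` are read as the linear functional f ↦ Σᵢ wᵢ f(aᵢ) on polynomials, and
  -- moments are its values on monomials. The bound in `Annihilates k` is strict: it concerns the
  -- polynomials of degree less than k.
  moment : Vector Carrier n → Vector Carrier n → ℕ → Carrier
  moment w a j = ∑[ i < _ ] (w i * a i ^ j)

  Annihilates : ℕ → Vector Carrier n → Vector Carrier n → Set ℓ
  Annihilates k w a = ∀ {j} → j < k → moment w a j ≈ 0#

  -- Apply the functional to Xʲ⁺¹ = (X - b) Xʲ + b Xʲ; multiplying the weights by aᵢ - b amounts to
  -- multiplying the polynomial by X - b.
  moment-suc : ∀ (w a : Vector Carrier n) b j →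
    moment w a (suc j) ≈ moment (λ i → w i * (a i - b)) a j + b * moment w a j
  moment-suc w a b j = begin
    moment w a (suc j)
      ≈⟨ sum-cong-≋ split ⟩
    ∑[ i < _ ] (w i * (a i - b) * a i ^ j + b * (w i * a i ^ j))
      ≈⟨ ∑-distrib-+ (λ i → w i * (a i - b) * a i ^ j) _ ⟩
    moment (λ i → w i * (a i - b)) a j + ∑[ i < _ ] (b * (w i * a i ^ j))
      ≈⟨ +-congˡ (*-distribˡ-sum b (λ i → w i * a i ^ j)) ⟨
    moment (λ i → w i * (a i - b)) a j + b * moment w a j
      ∎
    where
    split : ∀ i → w i * a i ^ suc j ≈ w i * (a i - b) * a i ^ j + b * (w i * a i ^ j)
    split i = begin
      w i * (a i * a i ^ j)
        ≈⟨ *-congˡ (*-congʳ ([x-y]+y≈x (a i) b)) ⟨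
      w i * ((a i - b + b) * a i ^ j)
        ≈⟨ solve 4 (λ w x b y → w :* ((x :+ b) :* y) := w :* x :* y :+ b :* (w :* y))
             refl (w i) (a i - b) b (a i ^ j) ⟩
      w i * (a i - b) * a i ^ j + b * (w i * a i ^ j)
        ∎

  -- Multiplication by X - b kills the node b. The tail weights are divided by aᵢ - b so that this
  -- multiplication gives back `w`, and the weight at b is chosen to make the total mass zero. Each
  -- moment of `w` then reappears one degree higher, up to b times a lower moment of `weights`.
  module DividedDifferenceStep (a : Vector Carrier (suc n)) (w : Vector Carrier n)
    (a≉b : ∀ i → ¬ tail a i ≈ head a) where
    private
      b = head a

    tailWeights : Vector Carrier n
    tailWeights i = w i * inv (tail a i - b)

    weights : Vector Carrier (suc n)
    weights = (- sum tailWeights) ∷ tailWeights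

    tailWeights-scale : ∀ i → tailWeights i * (tail a i - b) ≈ w i
    tailWeights-scale i = begin
      w i * inv (tail a i - b) * (tail a i - b)    ≈⟨ *-assoc _ _ _ ⟩
      w i * (inv (tail a i - b) * (tail a i - b))  ≈⟨ *-congˡ (inv-inverseˡ (x≉y⇒x-y≉0 (a≉b i))) ⟩
      w i * 1#                           ≈⟨ *-identityʳ _ ⟩
      w i                                ∎

    moment-weights-zero : moment weights a 0 ≈ 0#
    moment-weights-zero = begin
      - sum tailWeights * 1# + ∑[ i < n ] (tailWeights i * 1#)
        ≈⟨ +-cong (*-identityʳ _) (sum-cong-≋ λ i → *-identityʳ (tailWeights i)) ⟩
      - sum tailWeights + sum tailWeights
        ≈⟨ -‿inverseˡ (sum tailWeights) ⟩
      0#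
        ∎

    moment-weights-suc : ∀ j →
      moment weights a (suc j) ≈ moment w (tail a) j + b * moment weights a j
    moment-weights-suc j = begin
      moment weights a (suc j)
        ≈⟨ moment-suc weights a b j ⟩
      - sum tailWeights * (b - b) * b ^ j + moment (λ i → tailWeights i * (tail a i - b)) (tail a) j
        + b * moment weights a j
        ≈⟨ +-congʳ (+-cong (trans (*-congʳ (trans (*-congˡ (-‿inverseʳ b)) (zeroʳ _))) (zeroˡ _))
                           (sum-cong-≋ λ i → *-congʳ (tailWeights-scale i))) ⟩
      0# + moment w (tail a) j + b * moment weights a j
        ≈⟨ +-congʳ (+-identityˡ _) ⟩
      moment w (tail a) j + b * moment weights a j
        ∎

    annihilates-weights : ∀ {k} → Annihilates k w (tail a) → Annihilates (suc k) weights a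
    annihilates-weights ann {zero}  _         = moment-weights-zero
    annihilates-weights ann {suc j} (s≤s j<k) = begin
      moment weights a (suc j)                 ≈⟨ moment-weights-suc j ⟩
      moment w (tail a) j + b * moment weights a j
        ≈⟨ +-cong (ann j<k) (*-congˡ (annihilates-weights ann (ℕ.m<n⇒m<1+n j<k))) ⟩
      0# + b * 0#                                    ≈⟨ +-identityˡ _ ⟩
      b * 0#                                         ≈⟨ zeroʳ b ⟩
      0#                                             ∎

    moment-weights-leading : ∀ {k} → Annihilates k w (tail a) →
      moment weights a (suc k) ≈ moment w (tail a) k
    moment-weights-leading {k} ann = begin
      moment weights a (suc k)               ≈⟨ moment-weights-suc k ⟩
      moment w (tail a) k + b * moment weights a k
        ≈⟨ +-congˡ (trans (*-congˡ (annihilates-weights ann (ℕ.n<1+n k))) (zeroʳ b)) ⟩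
      moment w (tail a) k + 0#                            ≈⟨ +-identityʳ _ ⟩
      moment w (tail a) k                                 ∎

  -- The weights of the divided difference f[a₀,…,aₙ].
  dividedDifference : ∀ n (a : Vector Carrier (suc n)) → Injective _≡_ _≈_ a →
    ∃ λ w → Annihilates n w a × moment w a n ≈ 1#
  dividedDifference zero    a a-inj = (λ _ → 1#) , (λ ()) , trans (+-identityʳ _) (*-identityʳ _)
  dividedDifference (suc n) a a-inj = extend (dividedDifference n (tail a) (Fin.suc-injective ∘ a-inj))
    where
    extend : (∃ λ w → Annihilates n w (tail a) × moment w (tail a) n ≈ 1#) →
      ∃ λ w → Annihilates (suc n) w a × moment w a (suc n) ≈ 1#
    extend (w , ann , leading) =
      weights , annihilates-weights ann , trans (moment-weights-leading ann) leading
      where open DividedDifferenceStep a w (λ i eq → contradiction (a-inj eq) λ ())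

  -- The product is monic of degree m, so it differs from Xᵐ by terms that `w` kills. Formally, the
  -- factor X - b₀ is absorbed into the weights, which then annihilate one degree less.
  moment-product : ∀ (w a : Vector Carrier n) (b : Vector Carrier m) →
    Annihilates m w a → ∑[ i < n ] (w i * Π.sum (λ k → a i - b k)) ≈ moment w a m
  moment-product {m = zero}  w a b ann = refl
  moment-product {m = suc m} w a b ann = begin
    ∑[ i < _ ] (w i * ((a i - b zero) * Π.sum (λ k → a i - b (suc k))))
      ≈⟨ sum-cong-≋ (λ i → *-assoc (w i) _ _) ⟨
    ∑[ i < _ ] (w′ i * Π.sum (λ k → a i - b (suc k)))
      ≈⟨ moment-product w′ a (tail b) (λ {j} j<m → trans (w′-moment (ℕ.m<n⇒m<1+n j<m)) (ann (s≤s j<m))) ⟩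
    moment w′ a m
      ≈⟨ w′-moment (ℕ.n<1+n m) ⟩
    moment w a (suc m)
      ∎
    where
    w′ = λ i → w i * (a i - b zero)
    w′-moment : ∀ {j} → j < suc m → moment w′ a j ≈ moment w a (suc j)
    w′-moment {j} j<1+m = begin
      moment w′ a j                          ≈⟨ +-identityʳ _ ⟨
      moment w′ a j + 0#                     ≈⟨ +-congˡ (zeroʳ (b zero)) ⟨
      moment w′ a j + b zero * 0#            ≈⟨ +-congˡ (*-congˡ (ann j<1+m)) ⟨
      moment w′ a j + b zero * moment w a j  ≈⟨ moment-suc w a (b zero) j ⟨
      moment w a (suc j)                     ∎

  moment-const : ∀ (w a : Vector Carrier n) k {κ} → (∀ i → a i ^ k ≈ κ) →
    moment w a k ≈ κ * moment w a 0
  moment-const w a k {κ} a^k≈κ = begin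
    moment w a k                     ≈⟨ sum-cong-≋ scale ⟩
    sum (λ i → κ * (w i * a i ^ 0))  ≈⟨ *-distribˡ-sum κ (λ i → w i * a i ^ 0) ⟨
    κ * moment w a 0                 ∎
    where
    scale : ∀ i → w i * a i ^ k ≈ κ * (w i * 1#)
    scale i = begin
      w i * a i ^ k        ≈⟨ *-congˡ (a^k≈κ i) ⟩
      w i * κ              ≈⟨ *-comm (w i) κ ⟩
      κ * w i              ≈⟨ *-congˡ (*-identityʳ (w i)) ⟨
      κ * (w i * 1#)       ∎

  -- The divided difference of order n is 1 on Xⁿ but 0 on constants, as n is positive.
  xⁿ-fibre : 0 < n → ∀ κ (a : Vector Carrier (suc n)) → Injective _≡_ _≈_ a →
    ¬ (∀ i → a i ^ n ≈ κ)
  xⁿ-fibre {n} 0<n κ a a-inj a^n≈κ with w , ann , leading ← dividedDifference n a a-inj = 1≉0 (begin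
    1#                ≈⟨ leading ⟨
    moment w a n      ≈⟨ moment-const w a n a^n≈κ ⟩
    κ * moment w a 0  ≈⟨ *-congˡ (ann 0<n) ⟩
    κ * 0#            ≈⟨ zeroʳ κ ⟩
    0#                ∎)

  ∑-moments : ∀ (w a : Vector Carrier n) (c : Vector Carrier m) →
    ∑[ i < n ] (w i * ∑[ k < m ] (c k * a i ^ toℕ k)) ≈ ∑[ k < m ] (c k * moment w a (toℕ k))
  ∑-moments {n} {m} w a c = begin
    ∑[ i < n ] (w i * ∑[ k < m ] (c k * a i ^ toℕ k))
      ≈⟨ sum-cong-≋ (λ i → *-distribˡ-sum (w i) (λ k → c k * a i ^ toℕ k)) ⟩
    ∑[ i < n ] ∑[ k < m ] (w i * (c k * a i ^ toℕ k))
      ≈⟨ sum-cong-≋ (λ i → sum-cong-≋ λ k →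
           solve 3 (λ w c x → w :* (c :* x) := c :* (w :* x)) refl (w i) (c k) (a i ^ toℕ k)) ⟩
    ∑[ i < n ] ∑[ k < m ] (c k * (w i * a i ^ toℕ k))
      ≈⟨ ∑-comm (λ i k → c k * (w i * a i ^ toℕ k)) ⟩
    ∑[ k < m ] ∑[ i < n ] (c k * (w i * a i ^ toℕ k))
      ≈⟨ sum-cong-≋ (λ k → *-distribˡ-sum (c k) (λ i → w i * a i ^ toℕ k)) ⟨
    ∑[ k < m ] (c k * moment w a (toℕ k))
      ∎

  -- Polynomials of degree at most n with n + 1 zeros.

  ∑-zero : ∀ {t : Vector Carrier n} → (∀ i → t i ≈ 0#) → sum t ≈ 0#
  ∑-zero {n} t≈0 = trans (sum-cong-≋ t≈0) (sum-replicate-zero n)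

  -- The divided difference of order n extracts the coefficient of Xⁿ from a polynomial of degree at
  -- most n, and here it only sees zeros.
  vanishing⇒leading≈0 : ∀ n (c a : Vector Carrier (suc n)) → Injective _≡_ _≈_ a →
    (∀ i → ∑[ k ≤ n ] (c k * a i ^ toℕ k) ≈ 0#) → last c ≈ 0#
  vanishing⇒leading≈0 n c a a-inj vanish with dividedDifference n a a-inj
  ... | w , ann , lead = begin
    last c
      ≈⟨ *-identityʳ _ ⟨
    last c * 1#
      ≈⟨ *-congˡ (trans (reflexive (≡.cong (moment w a) (toℕ-fromℕ n))) lead) ⟨
    last c * moment w a (toℕ (fromℕ n))
      ≈⟨ +-identityˡ _ ⟨
    0# + last c * moment w a (toℕ (fromℕ n))
      ≈⟨ +-congʳ (∑-zero λ k → trans (*-congˡ (ann (≡.subst (_< n) (≡.sym (toℕ-inject₁ k)) (toℕ<n k)))) (zeroʳ _)) ⟨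
    ∑[ k < n ] (c (inject₁ k) * moment w a (toℕ (inject₁ k))) + last c * moment w a (toℕ (fromℕ n))
      ≈⟨ sum-init-last (λ k → c k * moment w a (toℕ k)) ⟨
    ∑[ k ≤ n ] (c k * moment w a (toℕ k))
      ≈⟨ ∑-moments w a c ⟨
    ∑[ i ≤ n ] (w i * ∑[ k ≤ n ] (c k * a i ^ toℕ k))
      ≈⟨ ∑-zero (λ i → trans (*-congˡ (vanish i)) (zeroʳ (w i))) ⟩
    0#
      ∎

  -- Once the leading term is known to vanish, it is dropped together with one node, and the shorter
  -- polynomial still vanishes at enough points.
  vanishing⇒coefficients≈0 : ∀ n (c a : Vector Carrier (suc n)) → Injective _≡_ _≈_ a →
    (∀ i → ∑[ k ≤ n ] (c k * a i ^ toℕ k) ≈ 0#) → ∀ k → c k ≈ 0#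
  vanishing⇒coefficients≈0 n c a a-inj vanish k with view k
  vanishing⇒coefficients≈0 n c a a-inj vanish _ | ‵fromℕ = vanishing⇒leading≈0 n c a a-inj vanish
  vanishing⇒coefficients≈0 (suc n) c a a-inj vanish _ | ‵inject₁ k =
    vanishing⇒coefficients≈0 n (init c) (tail a) (Fin.suc-injective ∘ a-inj) vanish′ k
    where
    vanish′ : ∀ i → ∑[ k ≤ n ] (c (inject₁ k) * a (suc i) ^ toℕ k) ≈ 0#
    vanish′ i = begin
      ∑[ k ≤ n ] (c (inject₁ k) * x ^ toℕ k)
        ≈⟨ sum-cong-≋ (λ k → *-congˡ {c (inject₁ k)} (reflexive (≡.cong (x ^_) (≡.sym (toℕ-inject₁ k))))) ⟩
      ∑[ k ≤ n ] (c (inject₁ k) * x ^ toℕ (inject₁ k))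
        ≈⟨ +-identityʳ _ ⟨
      ∑[ k ≤ n ] (c (inject₁ k) * x ^ toℕ (inject₁ k)) + 0#
        ≈⟨ +-congˡ (trans (*-congʳ (vanishing⇒leading≈0 (suc n) c a a-inj vanish)) (zeroˡ _)) ⟨
      ∑[ k ≤ n ] (c (inject₁ k) * x ^ toℕ (inject₁ k)) + last c * x ^ toℕ (fromℕ (suc n))
        ≈⟨ sum-init-last (λ k → c k * x ^ toℕ k) ⟨
      ∑[ k ≤ suc n ] (c k * x ^ toℕ k)
        ≈⟨ vanish (suc i) ⟩
      0#
        ∎
      where x = a (suc i)

  -- Moments through the binomial theorem.

  -- Expanding in powers of y puts exactly one moment of `s` into each coefficient: that of degree e
  -- - k at yᵏ.
  binomial-moments : ∀ e y (w s : Vector Carrier n) →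
    ∑[ i < n ] (w i * (y + s i) ^ e) ≈
    ∑[ k ≤ e ] ((e C toℕ k) · 1# * moment w s (e ∸ toℕ k) * y ^ toℕ k)
  binomial-moments {n} e y w s = begin
    ∑[ i < n ] (w i * (y + s i) ^ e)
      ≈⟨ sum-cong-≋ (λ i → *-congˡ (expand i)) ⟩
    ∑[ i < n ] (w i * ∑[ k ≤ e ] (B k * y ^ toℕ k * s i ^ (e ∸ toℕ k)))
      ≈⟨ sum-cong-≋ (λ i → *-distribˡ-sum (w i) (λ k → B k * y ^ toℕ k * s i ^ (e ∸ toℕ k))) ⟩
    ∑[ i < n ] ∑[ k ≤ e ] (w i * (B k * y ^ toℕ k * s i ^ (e ∸ toℕ k)))
      ≈⟨ ∑-comm (λ i k → w i * (B k * y ^ toℕ k * s i ^ (e ∸ toℕ k))) ⟩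
    ∑[ k ≤ e ] ∑[ i < n ] (w i * (B k * y ^ toℕ k * s i ^ (e ∸ toℕ k)))
      ≈⟨ sum-cong-≋ collect ⟩
    ∑[ k ≤ e ] (B k * moment w s (e ∸ toℕ k) * y ^ toℕ k)
      ∎
    where
    B : Vector Carrier (suc e)
    B k = (e C toℕ k) · 1#

    expand : ∀ i → (y + s i) ^ e ≈ ∑[ k ≤ e ] (B k * y ^ toℕ k * s i ^ (e ∸ toℕ k))
    expand i = trans (Binomial.theorem commutativeSemiring e y (s i)) (sum-cong-≋ λ k → begin
      (e C toℕ k) · (y ^ toℕ k * s i ^ (e ∸ toℕ k))
        ≈⟨ ×-congʳ (e C toℕ k) (*-identityˡ _) ⟨
      (e C toℕ k) · (1# * (y ^ toℕ k * s i ^ (e ∸ toℕ k)))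
        ≈⟨ ×-assoc-* (e C toℕ k) 1# _ ⟨
      B k * (y ^ toℕ k * s i ^ (e ∸ toℕ k))
        ≈⟨ *-assoc _ _ _ ⟨
      B k * y ^ toℕ k * s i ^ (e ∸ toℕ k)
        ∎)

    collect : ∀ k → ∑[ i < n ] (w i * (B k * y ^ toℕ k * s i ^ (e ∸ toℕ k)))
                  ≈ B k * moment w s (e ∸ toℕ k) * y ^ toℕ k
    collect k = begin
      ∑[ i < n ] (w i * (B k * Y * s i ^ j))
        ≈⟨ sum-cong-≋ (λ i → x∙yz≈y∙xz (w i) (B k * Y) (s i ^ j)) ⟩
      ∑[ i < n ] (B k * Y * (w i * s i ^ j))
        ≈⟨ *-distribˡ-sum (B k * Y) (λ i → w i * s i ^ j) ⟨
      B k * Y * moment w s j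
        ≈⟨ xy∙z≈xz∙y (B k) Y _ ⟩
      B k * moment w s j * Y
        ∎
      where
      Y = y ^ toℕ k
      j = e ∸ toℕ k

  -- The sum is a polynomial of degree at most e in y with e + 1 zeros, so all its coefficients
  -- vanish. The moment of degree j sits at the power k = e - j of y, and its binomial factor can be
  -- cancelled.
  annihilates-powers : ∀ e → (∀ (k : Fin (suc e)) → ¬ (e C toℕ k) · 1# ≈ 0#) →
    ∀ (w s : Vector Carrier n) (y : Vector Carrier (suc e)) → Injective _≡_ _≈_ y →
    (∀ k → ∑[ i < n ] (w i * (y k + s i) ^ e) ≈ 0#) → Annihilates (suc e) w s
  annihilates-powers e eCk≉0 w s y y-inj vanish {j} (s≤s j≤e) = begin
    moment w s j              ≡⟨ ≡.cong (moment w s) (ℕ.m∸[m∸n]≡n j≤e) ⟨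
    moment w s (e ∸ (e ∸ j))  ≡⟨ ≡.cong (λ i → moment w s (e ∸ i)) (Fin.toℕ-fromℕ< e∸j<1+e) ⟨
    moment w s (e ∸ toℕ k)    ≈⟨ xy≈0⇒y≈0 (eCk≉0 k) (vanishing⇒coefficients≈0 e (λ k → (e C toℕ k) · 1# * moment w s (e ∸ toℕ k)) y y-inj
                                   (λ i → trans (sym (binomial-moments e (y i) w s)) (vanish i)) k) ⟩
    0#                        ∎
    where
    e∸j<1+e = s≤s (ℕ.m∸n≤m e j)
    k = fromℕ< e∸j<1+e

  -- Linear relations between annihilating weights.

  ∏-zero : ∀ (t : Vector Carrier n) i → t i ≈ 0# → Π.sum t ≈ 0#
  ∏-zero t zero    t₀≈0 = trans (*-congʳ t₀≈0) (zeroˡ _)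
  ∏-zero t (suc i) tᵢ≈0 = trans (*-congˡ (∏-zero (tail t) i tᵢ≈0)) (zeroʳ _)

  x*∏≈0 : ∀ x (a : Vector Carrier n) i → x * Π.sum (λ k → a i - a k) ≈ 0#
  x*∏≈0 x a i = trans (*-congˡ (∏-zero (λ k → a i - a k) i (-‿inverseʳ (a i)))) (zeroʳ x)

  -- The product over the other nodes vanishes at every node but the head, so one summand survives.
  -- This shows later that the head weight is nonzero.
  moment-head : ∀ (w a : Vector Carrier (suc n)) → Annihilates n w a →
    w zero * Π.sum (λ k → a zero - a (suc k)) ≈ moment w a n
  moment-head {n} w a ann = begin
    w zero * Π.sum (λ k → a zero - a (suc k))
      ≈⟨ +-identityʳ _ ⟨
    w zero * Π.sum (λ k → a zero - a (suc k)) + 0#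
      ≈⟨ +-congˡ (∑-zero λ i → x*∏≈0 (w (suc i)) (tail a) i) ⟨
    ∑[ i ≤ n ] (w i * Π.sum (λ k → a i - a (suc k)))
      ≈⟨ moment-product w a (tail a) ann ⟩
    moment w a n
      ∎

  -- The product over the nodes from the third on leaves two summands. When the right side vanishes,
  -- this determines the ratio of the first two weights.
  moment-head₂ : ∀ (w a : Vector Carrier (suc (suc n))) → Annihilates n w a →
    w zero * Π.sum (λ k → a zero - a (suc (suc k))) +
    w (suc zero) * Π.sum (λ k → a (suc zero) - a (suc (suc k))) ≈ moment w a n
  moment-head₂ {n} w a ann = begin
    w zero * Π.sum (λ k → a zero - b k) + w (suc zero) * Π.sum (λ k → a (suc zero) - b k)
      ≈⟨ +-congˡ (+-identityʳ _) ⟨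
    w zero * Π.sum (λ k → a zero - b k) + (w (suc zero) * Π.sum (λ k → a (suc zero) - b k) + 0#)
      ≈⟨ +-congˡ (+-congˡ (∑-zero λ i → x*∏≈0 (w (suc (suc i))) b i)) ⟨
    ∑[ i < suc (suc n) ] (w i * Π.sum (λ k → a i - b k))
      ≈⟨ moment-product w a b ann ⟩
    moment w a n
      ∎
    where b = tail (tail a)

  cross-multiply : ∀ {x y u v} → x + y ≈ 0# → u + v ≈ 0# → x * v ≈ y * u
  cross-multiply {x} {y} {u} {v} x+y≈0 u+v≈0 = ∙-cancelʳ (y * v) _ _ (begin
    x * v + y * v   ≈⟨ distribʳ v x y ⟨
    (x + y) * v     ≈⟨ trans (*-congʳ x+y≈0) (zeroˡ v) ⟩
    0#              ≈⟨ trans (*-congˡ u+v≈0) (zeroʳ y) ⟨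
    y * (u + v)     ≈⟨ distribˡ y u v ⟩
    y * u + y * v   ∎)

  -- Cross ratios and inverses.

  [x-z]-[x-y]≈y-z : ∀ x y z → (x - z) - (x - y) ≈ y - z
  [x-z]-[x-y]≈y-z x y z = begin
    (x - z) - (x - y)   ≈⟨ +-congˡ (⁻¹-anti-homo‿- x y) ⟩
    (x - z) + (y - x)   ≈⟨ +-comm _ _ ⟩
    (y - x) + (x - z)   ≈⟨ +-assoc _ _ _ ⟨
    ((y - x) + x) - z   ≈⟨ +-congʳ ([x-y]+y≈x y x) ⟩
    y - z               ∎

  difference-of-inverses : ∀ {x y x′ y′} → x * y ≈ 1# → x′ * y′ ≈ 1# → (x - x′) * (y * y′) ≈ y′ - y
  difference-of-inverses {x} {y} {x′} {y′} xy≈1 x′y′≈1 = begin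
    (x - x′) * (y * y′)               ≈⟨ [y-z]x≈yx-zx (y * y′) x x′ ⟩
    x * (y * y′) - x′ * (y * y′)      ≈⟨ +-cong (trans (sym (*-assoc x y y′)) (trans (*-congʳ xy≈1) (*-identityˡ y′)))
                                         (-‿cong (trans (x∙yz≈y∙xz x′ y y′) (trans (*-congˡ x′y′≈1) (*-identityʳ y)))) ⟩
    y′ - y                            ∎

  -- The cross ratio of 0, x₁, x₂, x₃ is an ordinary ratio of differences of inverses.
  cross-ratio-of-inverses : ∀ {x₁ x₂ x₃ t₁ t₂ t₃ y₁ y₂ y₃ z₁ z₂ z₃} →
    x₁ * y₁ ≈ 1# → x₂ * y₂ ≈ 1# → x₃ * y₃ ≈ 1# → t₁ * z₁ ≈ 1# → t₂ * z₂ ≈ 1# → t₃ * z₃ ≈ 1# →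
    (x₃ * (t₃ - t₁)) * ((x₂ - x₁) * t₂) ≈ ((x₃ - x₁) * t₃) * (x₂ * (t₂ - t₁)) →
    (z₁ - z₃) * (y₁ - y₂) ≈ (y₁ - y₃) * (z₁ - z₂)
  cross-ratio-of-inverses {x₁} {x₂} {x₃} {t₁} {t₂} {t₃} {y₁} {y₂} {y₃} {z₁} {z₂} {z₃} xy₁ xy₂ xy₃ tz₁ tz₂ tz₃ eq = begin
    (z₁ - z₃) * (y₁ - y₂)
      ≈⟨ *-cong (difference-of-inverses tz₃ tz₁) (difference-of-inverses xy₂ xy₁) ⟨
    (t₃ - t₁) * (z₃ * z₁) * ((x₂ - x₁) * (y₂ * y₁))
      -- Inserting `x₃ * y₃` and `t₂ * z₂`, both equal to 1, completes the products of all the `yᵢ`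
      -- and all the `zᵢ`; what remains is the left side of `eq`.
      ≈⟨ pad xy₃ tz₂ ⟩
    (t₃ - t₁) * (z₃ * z₁) * ((x₂ - x₁) * (y₂ * y₁)) * (x₃ * y₃ * (t₂ * z₂))
      ≈⟨ CM.solve 10 (λ a b c d x₃ t₂ y₁ y₂ y₃ z₂ →
           ((a ⊕ (b ⊕ c)) ⊕ (d ⊕ (y₂ ⊕ y₁))) ⊕ ((x₃ ⊕ y₃) ⊕ (t₂ ⊕ z₂))
           ⊜ ((x₃ ⊕ a) ⊕ (d ⊕ t₂)) ⊕ (((y₁ ⊕ y₂) ⊕ y₃) ⊕ ((c ⊕ z₂) ⊕ b)))
           refl (t₃ - t₁) z₃ z₁ (x₂ - x₁) x₃ t₂ y₁ y₂ y₃ z₂ ⟩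
    (x₃ * (t₃ - t₁)) * ((x₂ - x₁) * t₂) * (y₁ * y₂ * y₃ * (z₁ * z₂ * z₃))
      ≈⟨ *-congʳ eq ⟩
    ((x₃ - x₁) * t₃) * (x₂ * (t₂ - t₁)) * (y₁ * y₂ * y₃ * (z₁ * z₂ * z₃))
      ≈⟨ CM.solve 10 (λ a b c d t₃ x₂ z₁ z₂ z₃ y₂ →
           ((a ⊕ (b ⊕ c)) ⊕ (d ⊕ (z₂ ⊕ z₁))) ⊕ ((t₃ ⊕ z₃) ⊕ (x₂ ⊕ y₂))
           ⊜ ((a ⊕ t₃) ⊕ (x₂ ⊕ d)) ⊕ (((c ⊕ y₂) ⊕ b) ⊕ ((z₁ ⊕ z₂) ⊕ z₃)))
           refl (x₃ - x₁) y₃ y₁ (t₂ - t₁) t₃ x₂ z₁ z₂ z₃ y₂ ⟨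
    (x₃ - x₁) * (y₃ * y₁) * ((t₂ - t₁) * (z₂ * z₁)) * (t₃ * z₃ * (x₂ * y₂))
      ≈⟨ pad tz₃ xy₂ ⟨
    (x₃ - x₁) * (y₃ * y₁) * ((t₂ - t₁) * (z₂ * z₁))
      ≈⟨ *-cong (difference-of-inverses xy₃ xy₁) (difference-of-inverses tz₂ tz₁) ⟩
    (y₁ - y₃) * (z₁ - z₂)
      ∎
    where
    pad : ∀ {p q u} → p ≈ 1# → q ≈ 1# → u ≈ u * (p * q)
    pad {p} {q} {u} p≈1 q≈1 = begin
      u               ≈⟨ *-identityʳ u ⟨
      u * 1#          ≈⟨ *-congˡ (*-identityʳ 1#) ⟨
      u * (1# * 1#)   ≈⟨ *-congˡ (*-cong p≈1 q≈1) ⟨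
      u * (p * q)     ∎

  -- Point sets whose differences have equal e-th powers.

  module PowersOfDifferences
    (e-1 : ℕ) (eCk≉0 : ∀ (k : Fin (2 ℕ.+ e-1)) → ¬ (suc e-1 C toℕ k) · 1# ≈ 0#)
    where

    private
      -- Positive by construction; `e-1` counts the points that remain when four out of e + 3 are
      -- singled out.
      e = suc e-1

    EqualPowers : (a s : Vector Carrier n) → Set ℓ
    EqualPowers a s = ∀ i j → (s i - s j) ^ e ≈ (a i - a j) ^ e

    equalPowers⇒injective : ∀ {a s : Vector Carrier n} →
      Injective _≡_ _≈_ a → EqualPowers a s → Injective _≡_ _≈_ s
    equalPowers⇒injective {a = a} {s} a-inj powers {i} {j} sᵢ≈sⱼ with a i ≟ a j
    ... | yes aᵢ≈aⱼ = a-inj aᵢ≈aⱼ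
    ... | no  aᵢ≉aⱼ = contradiction (begin
      (a i - a j) ^ e   ≈⟨ powers i j ⟨
      (s i - s j) ^ e   ≈⟨ ^-congˡ e (x≈y⇒x∙y⁻¹≈ε sᵢ≈sⱼ) ⟩
      0# ^ e            ≈⟨ zeroˡ (0# ^ e-1) ⟩
      0#                ∎) (^-≉0 e (x≉y⇒x-y≉0 aᵢ≉aⱼ))

    -- For each j the weights kill (X - aⱼ)ᵉ by degree, hence Σᵢ wᵢ (sᵢ - sⱼ)ᵉ = 0. Letting j run
    -- over the tail gives the e + 1 distinct zeros y = -sⱼ that `annihilates-powers` asks for.
    equalPowers⇒annihilates : ∀ {a s : Vector Carrier (suc (suc e))} (w : Vector Carrier (suc (suc e))) →
      Injective _≡_ _≈_ a → EqualPowers a s → Annihilates (suc e) w a → Annihilates (suc e) w s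
    equalPowers⇒annihilates {a} {s} w a-inj powers ann =
      annihilates-powers e eCk≉0 w s (λ k → - s (suc k))
        (Fin.suc-injective ∘ equalPowers⇒injective a-inj powers ∘ ⁻¹-injective) vanish
      where
      vanish : ∀ k → ∑[ i < suc (suc e) ] (w i * (- s (suc k) + s i) ^ e) ≈ 0#
      vanish k = begin
        ∑[ i < suc (suc e) ] (w i * (- s (suc k) + s i) ^ e)
          ≈⟨ sum-cong-≋ {suc (suc e)} (λ i → *-congˡ {w i} (trans (^-congˡ e (+-comm _ _))
               (trans (powers i (suc k)) (sym (Π.sum-replicate e))))) ⟩
        ∑[ i < suc (suc e) ] (w i * Π.sum (replicate e (a i - a (suc k))))
          ≈⟨ moment-product w a (replicate e (a (suc k))) (ann ∘ ℕ.m<n⇒m<1+n) ⟩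
        moment w a e
          ≈⟨ ann (ℕ.n<1+n e) ⟩
        0#
          ∎

    -- Both sides compare w₀ with w₁, for the weights w annihilating degree ≤ e on a and on s.
    equalPowers⇒proportional : ∀ {a s : Vector Carrier (suc (suc e))} →
      Injective _≡_ _≈_ a → EqualPowers a s →
      Π.sum (λ k → a zero - a (suc (suc k))) * Π.sum (λ k → s (suc zero) - s (suc (suc k))) ≈
      Π.sum (λ k → a (suc zero) - a (suc (suc k))) * Π.sum (λ k → s zero - s (suc (suc k)))
    equalPowers⇒proportional {a} {s} a-inj powers = helper (dividedDifference (suc e) a a-inj)
      where
      A₀ = Π.sum (λ k → a zero - a (suc (suc k)))
      A₁ = Π.sum (λ k → a (suc zero) - a (suc (suc k)))
      S₀ = Π.sum (λ k → s zero - s (suc (suc k)))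
      S₁ = Π.sum (λ k → s (suc zero) - s (suc (suc k)))

      A₀≉0 : ¬ A₀ ≈ 0#
      A₀≉0 = ∏-≉0 (λ k → a zero - a (suc (suc k))) λ k → x≉y⇒x-y≉0 λ eq → contradiction (a-inj eq) λ ()

      helper : (∃ λ w → Annihilates (suc e) w a × moment w a (suc e) ≈ 1#) → A₀ * S₁ ≈ A₁ * S₀
      helper (w , ann , leading) = *-cancelˡ (*-≉0 w₀≉0 w₁≉0) (begin
        w₀ * w₁ * (A₀ * S₁)     ≈⟨ interchange w₀ w₁ A₀ S₁ ⟩
        w₀ * A₀ * (w₁ * S₁)     ≈⟨ cross-multiply relationᵃ relationˢ ⟩
        w₁ * A₁ * (w₀ * S₀)     ≈⟨ interchange w₁ A₁ w₀ S₀ ⟩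
        w₁ * w₀ * (A₁ * S₀)     ≈⟨ *-congʳ (*-comm w₁ w₀) ⟩
        w₀ * w₁ * (A₁ * S₀)     ∎)
        where
        w₀ = w zero
        w₁ = w (suc zero)

        relationᵃ : w₀ * A₀ + w₁ * A₁ ≈ 0#
        relationᵃ = trans (moment-head₂ w a (ann ∘ ℕ.m<n⇒m<1+n)) (ann (ℕ.n<1+n e))

        annˢ : Annihilates (suc e) w s
        annˢ = equalPowers⇒annihilates w a-inj powers ann

        relationˢ : w₀ * S₀ + w₁ * S₁ ≈ 0#
        relationˢ = trans (moment-head₂ w s (annˢ ∘ ℕ.m<n⇒m<1+n)) (annˢ (ℕ.n<1+n e))

        w₀≉0 : ¬ w₀ ≈ 0#
        w₀≉0 w₀≈0 = 1≉0 (begin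
          1#                ≈⟨ leading ⟨
          moment w a (suc e) ≈⟨ moment-head w a ann ⟨
          w₀ * _            ≈⟨ trans (*-congʳ w₀≈0) (zeroˡ _) ⟩
          0#                ∎)

        w₁≉0 : ¬ w₁ ≈ 0#
        w₁≉0 w₁≈0 = *-≉0 w₀≉0 A₀≉0 (begin
          w₀ * A₀            ≈⟨ +-identityʳ _ ⟨
          w₀ * A₀ + 0#       ≈⟨ +-congˡ (trans (*-congʳ w₁≈0) (zeroˡ A₁)) ⟨
          w₀ * A₀ + w₁ * A₁  ≈⟨ relationᵃ ⟩
          0#                 ∎)

    -- Omitting point 2 or point 3 leaves e + 2 points, to which proportionality applies. One
    -- relation is multiplied by the reverse of the other, and the factors from the remaining e - 1
    -- points, collected in `K`, cancel.
    equalPowers⇒cross-ratio : ∀ {a s : Vector Carrier (4 ℕ.+ e-1)} →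
      Injective _≡_ _≈_ a → EqualPowers a s →
      (a 0F - a 3F) * (s 1F - s 3F) * ((a 1F - a 2F) * (s 0F - s 2F)) ≈
      (a 1F - a 3F) * (s 0F - s 3F) * ((a 0F - a 2F) * (s 1F - s 2F))
    equalPowers⇒cross-ratio {a} {s} a-inj powers = *-cancelˡ K≉0 (begin
      K * ((a 0F - a 3F) * (s 1F - s 3F) * ((a 1F - a 2F) * (s 0F - s 2F)))
        ≈⟨ rearrange A₀ S₁ A₁ S₀ _ _ _ _ ⟩
      (a 0F - a 3F) * A₀ * ((s 1F - s 3F) * S₁) * ((a 1F - a 2F) * A₁ * ((s 0F - s 2F) * S₀))
        ≈⟨ *-cong (proportional 2F) (sym (proportional 3F)) ⟩
      (a 1F - a 3F) * A₁ * ((s 0F - s 3F) * S₀) * ((a 0F - a 2F) * A₀ * ((s 1F - s 2F) * S₁))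
        ≈⟨ rearrange A₁ S₀ A₀ S₁ _ _ _ _ ⟨
      A₁ * S₀ * (A₀ * S₁) * ((a 1F - a 3F) * (s 0F - s 3F) * ((a 0F - a 2F) * (s 1F - s 2F)))
        ≈⟨ *-congʳ (*-comm _ _) ⟩
      K * ((a 1F - a 3F) * (s 0F - s 3F) * ((a 0F - a 2F) * (s 1F - s 2F)))
        ∎)
      where
      rest = λ (v : Vector Carrier (4 ℕ.+ e-1)) (i : Fin (4 ℕ.+ e-1)) (k : Fin e-1) → v i - v (suc (suc (suc (suc k))))
      A₀ = Π.sum (rest a 0F)
      A₁ = Π.sum (rest a 1F)
      S₀ = Π.sum (rest s 0F)
      S₁ = Π.sum (rest s 1F)
      K = A₀ * S₁ * (A₁ * S₀)

      proportional : ∀ i → _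
      proportional i = equalPowers⇒proportional {a ∘ punchIn i} {s ∘ punchIn i}
        (Fin.punchIn-injective i _ _ ∘ a-inj) (λ j k → powers (punchIn i j) (punchIn i k))

      s-inj = equalPowers⇒injective a-inj powers

      K≉0 : ¬ K ≈ 0#
      K≉0 = *-≉0
        (*-≉0 (∏-≉0 (rest a 0F) λ k → x≉y⇒x-y≉0 λ eq → contradiction (a-inj eq) λ ())
              (∏-≉0 (rest s 1F) λ k → x≉y⇒x-y≉0 λ eq → contradiction (s-inj eq) λ ()))
        (*-≉0 (∏-≉0 (rest a 1F) λ k → x≉y⇒x-y≉0 λ eq → contradiction (a-inj eq) λ ())
              (∏-≉0 (rest s 0F) λ k → x≉y⇒x-y≉0 λ eq → contradiction (s-inj eq) λ ()))

      rearrange : ∀ A₀ S₁ A₁ S₀ x y z w →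
        A₀ * S₁ * (A₁ * S₀) * (x * y * (z * w)) ≈ x * A₀ * (y * S₁) * (z * A₁ * (w * S₀))
      rearrange = CM.solve 8 (λ A₀ S₁ A₁ S₀ x y z w →
        ((A₀ ⊕ S₁) ⊕ (A₁ ⊕ S₀)) ⊕ ((x ⊕ y) ⊕ (z ⊕ w)) ⊜
        ((x ⊕ A₀) ⊕ (y ⊕ S₁)) ⊕ ((z ⊕ A₁) ⊕ (w ⊕ S₀))) refl

    -- The contradiction from p + 1 points and their p-th powers.

    module _ {m} (e-1≤m : e-1 ≤ m) (a : Vector Carrier (4 ℕ.+ m)) (a-inj : Injective _≡_ _≈_ a)
      (frobenius : ∀ i j → (a i - a j) ^ (3 ℕ.+ m) ≈ a i ^ (3 ℕ.+ m) - a j ^ (3 ℕ.+ m))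
      (powers : EqualPowers a (λ i → a i ^ (3 ℕ.+ m)))
      where

      private
        -- Written this way, p - 1 and p - 2 need no subtraction. The bound `e-1≤m` says e ≤ p - 2,
        -- so e + 3 of the p + 1 points can be chosen.
        p = 3 ℕ.+ m

        x t y z : Vector Carrier p
        x k = a 0F - a (suc k)
        t k = a 0F ^ p - a (suc k) ^ p
        y k = inv (x k)
        z k = inv (t k)

        x≉0 : ∀ k → ¬ x k ≈ 0#
        x≉0 k = x≉y⇒x-y≉0 λ eq → contradiction (a-inj eq) λ ()

        t≉0 : ∀ k → ¬ t k ≈ 0#
        t≉0 k = x≉y⇒x-y≉0 λ eq → contradiction (equalPowers⇒injective a-inj powers eq) λ ()

        xy≈1 : ∀ k → x k * y k ≈ 1#
        xy≈1 k = inv-inverseʳ (x≉0 k)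

        tz≈1 : ∀ k → t k * z k ≈ 1#
        tz≈1 k = inv-inverseʳ (t≉0 k)

        x-inj : Injective _≡_ _≈_ x
        x-inj = Fin.suc-injective ∘ a-inj ∘ ⁻¹-injective ∘ ∙-cancelˡ (a 0F) _ _

        y₀-y₁≉0 : ¬ y 0F - y 1F ≈ 0#
        y₀-y₁≉0 y₀-y₁≈0 = contradiction (x-inj (*-cancelˡ (inv-≉0 (x≉0 0F)) (begin
          y 0F * x 0F   ≈⟨ inv-inverseˡ (x≉0 0F) ⟩
          1#            ≈⟨ inv-inverseˡ (x≉0 1F) ⟨
          y 1F * x 1F   ≈⟨ *-congʳ (x∙y⁻¹≈ε⇒x≈y _ _ y₀-y₁≈0) ⟨
          y 0F * x 1F   ∎))) λ ()

        -- Inversion sends the point `a 0F` to infinity, and preservation of cross ratios becomes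
        -- the affine law z = γ + κ y. Its slope is read off from the first two indices.
        κ γ : Carrier
        κ = (z 0F - z 1F) * inv (y 0F - y 1F)
        γ = z 0F - y 0F * κ

        cross-ratio : ∀ k → (z 0F - z (suc (suc k))) * (y 0F - y 1F) ≈ (y 0F - y (suc (suc k))) * (z 0F - z 1F)
        cross-ratio k = cross-ratio-of-inverses
          (xy≈1 0F) (xy≈1 1F) (xy≈1 (suc (suc k))) (tz≈1 0F) (tz≈1 1F) (tz≈1 (suc (suc k)))
          (begin
            x (suc (suc k)) * (t (suc (suc k)) - t 0F) * ((x 1F - x 0F) * t 1F)
              ≈⟨ *-cong (*-congˡ ([x-z]-[x-y]≈y-z _ _ _)) (*-congʳ ([x-z]-[x-y]≈y-z _ _ _)) ⟩
            (a 0F - aₖ) * (a 1F ^ p - aₖ ^ p) * ((a 1F - a 2F) * (a 0F ^ p - a 2F ^ p))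
              ≈⟨ equalPowers⇒cross-ratio {a ∘ ι} {λ i → a (ι i) ^ p} (ι-inj ∘ a-inj) (λ i j → powers (ι i) (ι j)) ⟩
            (a 1F - aₖ) * (a 0F ^ p - aₖ ^ p) * ((a 0F - a 2F) * (a 1F ^ p - a 2F ^ p))
              ≈⟨ *-cong (*-congʳ ([x-z]-[x-y]≈y-z _ _ _)) (*-congˡ ([x-z]-[x-y]≈y-z _ _ _)) ⟨
            (x (suc (suc k)) - x 0F) * t (suc (suc k)) * (x 1F * (t 1F - t 0F))
              ∎)
          where
          aₖ = a (suc (suc (suc k)))
          -- Swapping positions 3 and k + 3 brings the chosen point among the first e + 3 positions
          -- and leaves positions 0, 1 and 2 alone.
          π = lift₀ (lift₀ (lift₀ (transpose 0F k)))
          ι : Fin (4 ℕ.+ e-1) → Fin (4 ℕ.+ m)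
          ι i = π ⟨$⟩ʳ inject≤ i (ℕ.+-monoʳ-≤ 4 e-1≤m)
          ι-inj : Injective _≡_ _≡_ ι
          ι-inj = Fin.inject≤-injective _ _ _ _ ∘ Injection.injective (↔⇒↣ π)

        z-affine : ∀ k → z 0F - z k ≈ (y 0F - y k) * κ
        z-affine 0F = begin
          z 0F - z 0F         ≈⟨ -‿inverseʳ _ ⟩
          0#                  ≈⟨ zeroˡ κ ⟨
          0# * κ              ≈⟨ *-congʳ (-‿inverseʳ _) ⟨
          (y 0F - y 0F) * κ   ∎
        z-affine (suc k) = *-cancelˡ y₀-y₁≉0 (begin
          (y 0F - y 1F) * (z 0F - z (suc k))
            ≈⟨ *-comm _ _ ⟩
          (z 0F - z (suc k)) * (y 0F - y 1F)
            ≈⟨ scaled k ⟩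
          (y 0F - y (suc k)) * (z 0F - z 1F)
            ≈⟨ *-congˡ (trans (*-congˡ (inv-inverseʳ y₀-y₁≉0)) (*-identityʳ _)) ⟨
          (y 0F - y (suc k)) * ((z 0F - z 1F) * ((y 0F - y 1F) * inv (y 0F - y 1F)))
            ≈⟨ CM.solve 4 (λ a b c d → a ⊕ (b ⊕ (c ⊕ d)) ⊜ c ⊕ (a ⊕ (b ⊕ d))) refl _ _ _ _ ⟩
          (y 0F - y 1F) * ((y 0F - y (suc k)) * κ)
            ∎)
          where
          scaled : ∀ k → (z 0F - z (suc k)) * (y 0F - y 1F) ≈ (y 0F - y (suc k)) * (z 0F - z 1F)
          scaled 0F      = *-comm _ _
          scaled (suc k) = cross-ratio k

        u : Vector Carrier p
        u k = x k * z k

        -- Multiply z = γ + κ y by x and use x y = 1.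
        u-affine : ∀ k → u k ≈ γ * x k + κ
        u-affine k = begin
          x k * z k
            ≈⟨ *-congˡ (y≈x-[x-y] (z 0F) (z k)) ⟩
          x k * (z 0F - (z 0F - z k))
            ≈⟨ *-congˡ (+-congˡ (-‿cong (z-affine k))) ⟩
          x k * (z 0F - (y 0F - y k) * κ)
            ≈⟨ *-congˡ (trans (+-congˡ (-‿cong ([y-z]x≈yx-zx κ _ _))) (x-[y-z]≈[x-y]+z _ _ _)) ⟩
          x k * (γ + y k * κ)
            ≈⟨ distribˡ (x k) γ _ ⟩
          x k * γ + x k * (y k * κ)
            ≈⟨ +-cong (*-comm _ _) (trans (sym (*-assoc _ _ _)) (trans (*-congʳ (xy≈1 k)) (*-identityˡ κ))) ⟩
          γ * x k + κ
            ∎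
          where
          x-[y-z]≈[x-y]+z : ∀ x y z → x - (y - z) ≈ (x - y) + z
          x-[y-z]≈[x-y]+z x y z = begin
            x - (y - z)   ≈⟨ +-congˡ (trans (⁻¹-anti-homo‿- y z) (+-comm _ _)) ⟩
            x + (- y + z) ≈⟨ +-assoc _ _ _ ⟨
            (x - y) + z   ∎
          y≈x-[x-y] : ∀ x y → y ≈ x - (x - y)
          y≈x-[x-y] x y = begin
            y             ≈⟨ [x-y]+y≈x y x ⟨
            (y - x) + x   ≈⟨ +-comm _ _ ⟩
            x + (y - x)   ≈⟨ +-congˡ (⁻¹-anti-homo‿- x y) ⟨
            x - (x - y)   ∎

        u^e≈1 : ∀ k → u k ^ e ≈ 1#
        u^e≈1 k = begin
          (x k * z k) ^ e     ≈⟨ ^-distrib-* (x k) (z k) e ⟩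
          x k ^ e * z k ^ e   ≈⟨ *-congʳ (powers 0F (suc k)) ⟨
          t k ^ e * z k ^ e   ≈⟨ ^-distrib-* (t k) (z k) e ⟨
          (t k * z k) ^ e     ≈⟨ ^-congˡ e (tz≈1 k) ⟩
          1# ^ e              ≈⟨ 1^n≈1 e ⟩
          1#                  ∎

        γ≉0⇒u-inj : ¬ γ ≈ 0# → Injective _≡_ _≈_ u
        γ≉0⇒u-inj γ≉0 {i} {j} uᵢ≈uⱼ = x-inj (*-cancelˡ γ≉0 (∙-cancelʳ κ _ _
          (trans (sym (u-affine i)) (trans uᵢ≈uⱼ (u-affine j)))))

        -- Now x z = κ, while xᵖ = t by `frobenius`; hence κ xᵖ⁻¹ = xᵖ z = t z = 1.
        γ≈0⇒κx^[p-1]≈1 : γ ≈ 0# → ∀ k → κ * x k ^ (2 ℕ.+ m) ≈ 1#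
        γ≈0⇒κx^[p-1]≈1 γ≈0 k = begin
          κ * x k ^ (2 ℕ.+ m)          ≈⟨ *-congʳ (trans (u-affine k) (trans (+-congʳ (trans (*-congʳ γ≈0) (zeroˡ _))) (+-identityˡ κ))) ⟨
          x k * z k * x k ^ (2 ℕ.+ m)  ≈⟨ xy∙z≈xz∙y _ _ _ ⟩
          x k ^ p * z k                ≈⟨ *-congʳ (frobenius 0F (suc k)) ⟩
          t k * z k                    ≈⟨ tz≈1 k ⟩
          1#                           ∎

      ¬equalPowers-frobenius : ⊥
      ¬equalPowers-frobenius with γ ≟ 0#
      ... | no γ≉0 = xⁿ-fibre (s≤s z≤n) 1# (λ i → u (inject≤ i 1+e≤p))
          (Fin.inject≤-injective _ _ _ _ ∘ γ≉0⇒u-inj γ≉0) (λ i → u^e≈1 (inject≤ i 1+e≤p))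
        where
        1+e≤p : suc e ≤ p
        1+e≤p = s≤s (s≤s (ℕ.m≤n⇒m≤1+n e-1≤m))
      -- All p entries of `x` have the same (p - 1)-st power, one point too many for that degree.
      ... | yes γ≈0 = xⁿ-fibre (s≤s z≤n) (inv κ) x x-inj λ k → *-cancelˡ κ≉0
          (trans (γ≈0⇒κx^[p-1]≈1 γ≈0 k) (sym (inv-inverseʳ κ≉0)))
        where
        κ≉0 : ¬ κ ≈ 0#
        κ≉0 κ≈0 = 1≉0 (trans (sym (γ≈0⇒κx^[p-1]≈1 γ≈0 0F)) (trans (*-congʳ κ≈0) (zeroˡ _)))

  -- Multiples of 1, binomial coefficients and the Frobenius map.

  [n*m]·1≈0 : ∀ {m} n → m · 1# ≈ 0# → (n ℕ.* m) · 1# ≈ 0#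
  [n*m]·1≈0 {m} n m·1≈0 = begin
    (n ℕ.* m) · 1#        ≈⟨ ×1-homo-* n m ⟩
    (n · 1#) * (m · 1#)   ≈⟨ trans (*-congˡ m·1≈0) (zeroʳ _) ⟩
    0#                    ∎

  -- A product in a field vanishes only if a factor does. This leads from the order p³ of the field
  -- to p · 1 = 0.
  [m^n]·1≈0⇒m·1≈0 : ∀ m n → (m ℕ.^ n) · 1# ≈ 0# → m · 1# ≈ 0#
  [m^n]·1≈0⇒m·1≈0 m zero    1·1≈0 = contradiction (trans (sym (×-homo-1 1#)) 1·1≈0) 1≉0
  [m^n]·1≈0⇒m·1≈0 m (suc n) m^n·1≈0 with (m · 1#) ≟ 0#
  ... | yes m·1≈0 = m·1≈0
  ... | no  m·1≉0 = [m^n]·1≈0⇒m·1≈0 m n (xy≈0⇒y≈0 m·1≉0 (trans (sym (×1-homo-* m (m ℕ.^ n))) m^n·1≈0))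

  -- The factorial formula with its denominator moved across, so that both the vanishing and the
  -- nonvanishing of binomial coefficients can be read off in the field.
  k![n∸k]!·1*nCk·1≈n!·1 : ∀ {n k} → k ≤ n → ((k ! ℕ.* (n ∸ k) !) · 1#) * ((n C k) · 1#) ≈ (n !) · 1#
  k![n∸k]!·1*nCk·1≈n!·1 {n} {k} k≤n = begin
    ((k ! ℕ.* (n ∸ k) !) · 1#) * ((n C k) · 1#)   ≈⟨ ×1-homo-* (k ! ℕ.* (n ∸ k) !) (n C k) ⟨
    (k ! ℕ.* (n ∸ k) ! ℕ.* (n C k)) · 1#          ≡⟨ ≡.cong (_· 1#) eq ⟩
    (n !) · 1#                                    ∎
    where
    eq : k ! ℕ.* (n ∸ k) ! ℕ.* (n C k) ≡ n !
    eq = ≡.trans (≡.cong (k ! ℕ.* (n ∸ k) ! ℕ.*_) (nCk≡n!/k![n-k]! k≤n))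
      (m*[n/m]≡n {{ℕ._!*_!≢0 k (n ∸ k)}} (k![n∸k]!∣n! k≤n))

  [x+y]^n≈x^n+y^n : 0 < n → (∀ {k} → 0 < k → k < n → (n C k) · 1# ≈ 0#) →
    ∀ x y → (x + y) ^ n ≈ x ^ n + y ^ n
  [x+y]^n≈x^n+y^n {suc n} _ nCk·1≈0 x y = begin
    (x + y) ^ suc n
      ≈⟨ Binomial.theorem commutativeSemiring (suc n) x y ⟩
    term zero + sum (tail term)
      ≈⟨ +-cong first (trans (sum-init-last (tail term)) (+-cong (∑-zero middle) final)) ⟩
    y ^ suc n + (0# + x ^ suc n)
      ≈⟨ trans (+-comm _ _) (+-congʳ (+-identityˡ _)) ⟩
    x ^ suc n + y ^ suc n
      ∎
    where
    term : Vector Carrier (2 ℕ.+ n)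
    term k = (suc n C toℕ k) · (x ^ toℕ k * y ^ (suc n ∸ toℕ k))

    first : term zero ≈ y ^ suc n
    first = begin
      (suc n C 0) · (1# * y ^ suc n)   ≡⟨ ≡.cong (_· (1# * y ^ suc n)) (≡.trans (nCk≡nC[n∸k] {n = suc n} z≤n) (nCn≡1 (suc n))) ⟩
      1 · (1# * y ^ suc n)             ≈⟨ trans (×-homo-1 _) (*-identityˡ _) ⟩
      y ^ suc n                        ∎

    final : last (tail term) ≈ x ^ suc n
    final = begin
      (suc n C suc (toℕ (fromℕ n))) · (x ^ suc (toℕ (fromℕ n)) * y ^ (n ∸ toℕ (fromℕ n)))
        ≡⟨ ≡.cong (λ k → (suc n C suc k) · (x ^ suc k * y ^ (n ∸ k))) (toℕ-fromℕ n) ⟩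
      (suc n C suc n) · (x ^ suc n * y ^ (n ∸ n))
        ≡⟨ ≡.cong₂ (λ c k → c · (x ^ suc n * y ^ k)) (nCn≡1 (suc n)) (ℕ.n∸n≡0 n) ⟩
      1 · (x ^ suc n * 1#)
        ≈⟨ trans (×-homo-1 _) (*-identityʳ _) ⟩
      x ^ suc n
        ∎

    middle : ∀ k → init (tail term) k ≈ 0#
    middle k = begin
      (suc n C j) · z          ≈⟨ ×-congʳ (suc n C j) (*-identityˡ z) ⟨
      (suc n C j) · (1# * z)   ≈⟨ ×-assoc-* (suc n C j) 1# z ⟨
      (suc n C j) · 1# * z     ≈⟨ *-congʳ (nCk·1≈0 (s≤s z≤n) (s≤s (≡.subst (_< n) (≡.sym (toℕ-inject₁ k)) (toℕ<n k)))) ⟩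
      0# * z                   ≈⟨ zeroˡ z ⟩
      0#                       ∎
      where
      j = suc (toℕ (inject₁ k))
      z = x ^ j * y ^ (suc n ∸ j)

  ∸·1≈0 : ∀ {m n} → m < n → m · 1# ≈ n · 1# → (n ∸ m) · 1# ≈ 0#
  ∸·1≈0 {m} {n} m<n m·1≈n·1 = ∙-cancelʳ (m · 1#) _ _ (begin
    (n ∸ m) · 1# + m · 1#   ≈⟨ ×-homo-+ 1# (n ∸ m) m ⟨
    (n ∸ m ℕ.+ m) · 1#      ≡⟨ ≡.cong (_· 1#) (ℕ.m∸n+n≡m (ℕ.<⇒≤ m<n)) ⟩
    n · 1#                  ≈⟨ m·1≈n·1 ⟨
    m · 1#                  ≈⟨ +-identityˡ _ ⟨
    0# + m · 1#             ∎)

  1+m≡n⇒¬both≈0 : ∀ {m n} → suc m ≡ n → m · 1# ≈ 0# → ¬ n · 1# ≈ 0#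
  1+m≡n⇒¬both≈0 ≡.refl m·1≈0 n·1≈0 = 1≉0 (trans (sym (trans (+-congˡ m·1≈0) (+-identityʳ 1#))) n·1≈0)

  module Characteristic {p} (p-prime : Prime p) (p·1≈0 : p · 1# ≈ 0#) where

    private
      instance
        _ = prime⇒nonZero p-prime

    -- Bézout yields a multiple of n and a multiple of p that are consecutive integers; their images
    -- in the field differ by 1 and cannot both be zero.
    n·1≉0 : 0 < n → n < p → ¬ n · 1# ≈ 0#
    n·1≉0 {n} 0<n n<p n·1≈0 with coprime-Bézout (prime⇒coprime p-prime {{ℕ.>-nonZero 0<n}} n<p)
    ... | Bézout.Identity.+- x y 1+yn≡xp = 1+m≡n⇒¬both≈0 1+yn≡xp ([n*m]·1≈0 y n·1≈0) ([n*m]·1≈0 x p·1≈0)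
    ... | Bézout.Identity.-+ x y 1+xp≡yn = 1+m≡n⇒¬both≈0 1+xp≡yn ([n*m]·1≈0 x p·1≈0) ([n*m]·1≈0 y n·1≈0)

    n!·1≉0 : n < p → ¬ (n !) · 1# ≈ 0#
    n!·1≉0 {zero}  _   = 1≉0 ∘ trans (sym (×-homo-1 1#))
    n!·1≉0 {suc n} n<p = *-≉0 (n·1≉0 (s≤s z≤n) n<p) (n!·1≉0 (ℕ.<-trans (ℕ.n<1+n n) n<p)) ∘ trans (sym (×1-homo-* (suc n) (n !)))

    nCk·1≉0 : ∀ {k} → k ≤ n → n < p → ¬ (n C k) · 1# ≈ 0#
    nCk·1≉0 {n} {k} k≤n n<p nCk·1≈0 = n!·1≉0 n<p (begin
      (n !) · 1#   ≈⟨ k![n∸k]!·1*nCk·1≈n!·1 k≤n ⟨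
      ((k ! ℕ.* (n ∸ k) !) · 1#) * ((n C k) · 1#)   ≈⟨ trans (*-congˡ nCk·1≈0) (zeroʳ _) ⟩
      0#   ∎)

    -- The factor p of p! maps to zero, while k! (p - k)! does not, both k and p - k being less than
    -- p.
    pCk·1≈0 : ∀ {k} → 0 < k → k < p → (p C k) · 1# ≈ 0#
    pCk·1≈0 {k} 0<k k<p = xy≈0⇒y≈0 k![p∸k]!·1≉0 (begin
      ((k ! ℕ.* (p ∸ k) !) · 1#) * ((p C k) · 1#)
        ≈⟨ k![n∸k]!·1*nCk·1≈n!·1 (ℕ.<⇒≤ k<p) ⟩
      (p !) · 1#
        ≡⟨ ≡.cong (_· 1#) p!≡[p-1]!*p ⟩
      ((ℕ.pred p !) ℕ.* p) · 1#
        ≈⟨ [n*m]·1≈0 (ℕ.pred p !) p·1≈0 ⟩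
      0#
        ∎)
      where
      k![p∸k]!·1≉0 : ¬ (k ! ℕ.* (p ∸ k) !) · 1# ≈ 0#
      k![p∸k]!·1≉0 = *-≉0 (n!·1≉0 k<p) (n!·1≉0 (ℕ.∸-monoʳ-< 0<k (ℕ.<⇒≤ k<p))) ∘ trans (sym (×1-homo-* (k !) ((p ∸ k) !)))
      p!≡[p-1]!*p : p ! ≡ (ℕ.pred p !) ℕ.* p
      p!≡[p-1]!*p = ≡.trans (≡.cong _! (≡.sym (ℕ.suc-pred p)))
        (≡.trans (ℕ.*-comm (suc (ℕ.pred p)) (ℕ.pred p !)) (≡.cong (ℕ.pred p ! ℕ.*_) (ℕ.suc-pred p)))

    frobenius : ∀ x y → (x + y) ^ p ≈ x ^ p + y ^ p
    frobenius = [x+y]^n≈x^n+y^n (ℕ.>-nonZero⁻¹ p) pCk·1≈0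

    -- Additivity is applied to x = (x - y) + y, which avoids evaluating (-1)ᵖ.
    frobenius-difference : ∀ x y → (x - y) ^ p ≈ x ^ p - y ^ p
    frobenius-difference x y = ∙-cancelʳ (y ^ p) _ _ (begin
      (x - y) ^ p + y ^ p   ≈⟨ frobenius (x - y) y ⟨
      (x - y + y) ^ p       ≈⟨ ^-congˡ p ([x-y]+y≈x x y) ⟩
      x ^ p                 ≈⟨ [x-y]+y≈x (x ^ p) (y ^ p) ⟨
      x ^ p - y ^ p + y ^ p ∎)

    [n·1]^p≈n·1 : ∀ n → (n · 1#) ^ p ≈ n · 1#
    [n·1]^p≈n·1 zero    = trans (^-congʳ 0# (≡.sym (ℕ.suc-pred p))) (zeroˡ _)
    [n·1]^p≈n·1 (suc n) = begin
      (1# + n · 1#) ^ p         ≈⟨ frobenius 1# (n · 1#) ⟩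
      1# ^ p + (n · 1#) ^ p     ≈⟨ +-cong (1^n≈1 p) ([n·1]^p≈n·1 n) ⟩
      1# + n · 1#               ∎

    n·1-injective : ∀ {m n} → m < p → n < p → m · 1# ≈ n · 1# → m ≡ n
    n·1-injective {m} {n} m<p n<p m·1≈n·1 with ℕ.<-cmp m n
    ... | tri≈ _ m≡n _ = m≡n
    ... | tri< m<n _ _ = contradiction (∸·1≈0 m<n m·1≈n·1) (n·1≉0 (ℕ.m<n⇒0<n∸m m<n) (ℕ.≤-<-trans (ℕ.m∸n≤m n m) n<p))
    ... | tri> _ _ n<m = contradiction (∸·1≈0 n<m (sym m·1≈n·1)) (n·1≉0 (ℕ.m<n⇒0<n∸m n<m) (ℕ.≤-<-trans (ℕ.m∸n≤m m n) m<p))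

  -- Geometric sums and roots of unity.

  -- geometricSum c k u = (uᵏ − cᵏ) / (u − c)
  geometricSum : Carrier → ℕ → Carrier → Carrier
  geometricSum c zero    u = 0#
  geometricSum c (suc k) u = u ^ k + c * geometricSum c k u

  [u-c]*geometricSum : ∀ c k u → (u - c) * geometricSum c k u ≈ u ^ k - c ^ k
  [u-c]*geometricSum c zero    u = trans (zeroʳ _) (sym (-‿inverseʳ 1#))
  [u-c]*geometricSum c (suc k) u = begin
    (u - c) * (u ^ k + c * G)
      ≈⟨ distribˡ (u - c) (u ^ k) (c * G) ⟩
    (u - c) * u ^ k + (u - c) * (c * G)
      ≈⟨ +-cong ([y-z]x≈yx-zx (u ^ k) u c) (trans (x∙yz≈y∙xz (u - c) c G) (*-congˡ ([u-c]*geometricSum c k u))) ⟩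
    (u * u ^ k - c * u ^ k) + c * (u ^ k - c ^ k)
      ≈⟨ +-congˡ (x[y-z]≈xy-xz c (u ^ k) (c ^ k)) ⟩
    (u * u ^ k - c * u ^ k) + (c * u ^ k - c * c ^ k)
      ≈⟨ +-assoc _ _ _ ⟨
    ((u * u ^ k - c * u ^ k) + c * u ^ k) - c * c ^ k
      ≈⟨ +-congʳ ([x-y]+y≈x _ _) ⟩
    u * u ^ k - c * c ^ k
      ∎
    where G = geometricSum c k u

  -- With u = Xᴹ the geometric sum of k + 1 terms is monic of degree M k in X. As M is positive, its
  -- other terms have smaller degree and are killed.
  moment-geometricSum : ∀ M c k (w a : Vector Carrier n) → Annihilates (M ℕ.* k) w a → 0 < M →
    ∑[ i < n ] (w i * geometricSum c (suc k) (a i ^ M)) ≈ moment w a (M ℕ.* k)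
  moment-geometricSum {n} M c k w a ann 0<M = begin
    ∑[ i < n ] (w i * ((a i ^ M) ^ k + c * g i))
      ≈⟨ sum-cong-≋ {n} split ⟩
    ∑[ i < n ] (w i * a i ^ (M ℕ.* k) + c * (w i * g i))
      ≈⟨ ∑-distrib-+ (λ i → w i * a i ^ (M ℕ.* k)) (λ i → c * (w i * g i)) ⟩
    moment w a (M ℕ.* k) + ∑[ i < n ] (c * (w i * g i))
      ≈⟨ +-congˡ (*-distribˡ-sum c (λ i → w i * g i)) ⟨
    moment w a (M ℕ.* k) + c * ∑[ i < n ] (w i * g i)
      ≈⟨ +-congˡ (trans (*-congˡ (lower k ann)) (zeroʳ c)) ⟩
    moment w a (M ℕ.* k) + 0#
      ≈⟨ +-identityʳ _ ⟩
    moment w a (M ℕ.* k)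
      ∎
    where
    g : Vector Carrier n
    g i = geometricSum c k (a i ^ M)

    split : ∀ i → w i * ((a i ^ M) ^ k + c * g i) ≈ w i * a i ^ (M ℕ.* k) + c * (w i * g i)
    split i = begin
      w i * ((a i ^ M) ^ k + c * g i)           ≈⟨ distribˡ (w i) _ _ ⟩
      w i * (a i ^ M) ^ k + w i * (c * g i)     ≈⟨ +-cong (*-congˡ (^-assocʳ (a i) M k)) (x∙yz≈y∙xz (w i) c (g i)) ⟩
      w i * a i ^ (M ℕ.* k) + c * (w i * g i)   ∎

    lower : ∀ k → Annihilates (M ℕ.* k) w a → ∑[ i < n ] (w i * geometricSum c k (a i ^ M)) ≈ 0#
    lower zero    ann = ∑-zero λ i → zeroʳ (w i)
    lower (suc k) ann = trans
      (moment-geometricSum M c k w a (λ j<Mk → ann (ℕ.<-trans j<Mk Mk<M[1+k])) 0<M) (ann Mk<M[1+k])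
      where
      Mk<M[1+k] : M ℕ.* k < M ℕ.* suc k
      Mk<M[1+k] = ℕ.*-monoʳ-< M {{ℕ.>-nonZero 0<M}} (ℕ.n<1+n k)

  -- If u = aᵢᴹ always differs from c, then (uᵏ⁺¹ - cᵏ⁺¹) / (u - c) vanishes at M k + 1 distinct
  -- points, although it is a monic polynomial of degree M k in aᵢ.
  powers-exhaust-roots : ∀ {M k c} → 0 < M → c ^ suc k ≈ 1# →
    (a : Vector Carrier (suc (M ℕ.* k))) → Injective _≡_ _≈_ a →
    (∀ i → (a i ^ M) ^ suc k ≈ 1#) → ¬ (∀ i → ¬ a i ^ M ≈ c)
  powers-exhaust-roots {M} {k} {c} 0<M c^k≈1 a a-inj a^Mk≈1 a^M≉c
    with w , ann , leading ← dividedDifference (M ℕ.* k) a a-inj = 1≉0 (begin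
      1#                       ≈⟨ leading ⟨
      moment w a (M ℕ.* k)     ≈⟨ moment-geometricSum M c k w a ann 0<M ⟨
      ∑[ i ≤ M ℕ.* k ] (w i * geometricSum c (suc k) (a i ^ M))
        ≈⟨ ∑-zero (λ i → trans (*-congˡ (vanish i)) (zeroʳ (w i))) ⟩
      0#                       ∎)
    where
    vanish : ∀ i → geometricSum c (suc k) (a i ^ M) ≈ 0#
    vanish i = xy≈0⇒y≈0 (x≉y⇒x-y≉0 (a^M≉c i)) (begin
      (a i ^ M - c) * geometricSum c (suc k) (a i ^ M)  ≈⟨ [u-c]*geometricSum c (suc k) (a i ^ M) ⟩
      (a i ^ M) ^ suc k - c ^ suc k                     ≈⟨ x≈y⇒x∙y⁻¹≈ε (trans (a^Mk≈1 i) (sym c^k≈1)) ⟩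
      0#                                                ∎)

  -- Finite fields.

  module Finite {q-1} (enumeration : Inverse setoid (≡.setoid (Fin (suc q-1)))) where
    open Inverse enumeration using (to; from; to-cong; strictlyInverseˡ; strictlyInverseʳ)

    private
      q = suc q-1

    bijection⇒permutation : (f g : Carrier → Carrier) →
      (∀ {x y} → x ≈ y → f x ≈ f y) → (∀ {x y} → x ≈ y → g x ≈ g y) →
      (∀ x → f (g x) ≈ x) → (∀ x → g (f x) ≈ x) → Permutation q q
    bijection⇒permutation f g f-cong g-cong fg≈id gf≈id = permutation (to ∘ f ∘ from) (to ∘ g ∘ from)
      (λ i → ≡.trans (to-cong (trans (f-cong (strictlyInverseʳ _)) (fg≈id _))) (strictlyInverseˡ i))
      (λ i → ≡.trans (to-cong (trans (g-cong (strictlyInverseʳ _)) (gf≈id _))) (strictlyInverseˡ i))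

    -- Translation by 1 permutes the field, so adding 1 to every element leaves the sum of all
    -- elements unchanged.
    q·1≈0 : q · 1# ≈ 0#
    q·1≈0 = ∙-cancelˡ (sum from) _ _ (begin
      sum from + q · 1#                      ≈⟨ +-congˡ (sum-replicate q) ⟨
      sum from + sum (replicate q 1#)        ≈⟨ ∑-distrib-+ from (replicate q 1#) ⟨
      ∑[ i < q ] (from i + 1#)               ≈⟨ sum-cong-≋ {q} (λ i → strictlyInverseʳ (from i + 1#)) ⟨
      ∑[ i < q ] from (to (from i + 1#))     ≈⟨ sum-permute from translation ⟨
      sum from                               ≈⟨ +-identityʳ _ ⟨
      sum from + 0#                          ∎)
      where
      translation : Permutation q q
      translation = bijection⇒permutation (_+ 1#) (_- 1#) +-congʳ +-congʳ
        (λ x → [x-y]+y≈x x 1#)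
        (λ x → trans (+-assoc _ _ _) (trans (+-congˡ (-‿inverseʳ 1#)) (+-identityʳ x)))

    nonzero : Vector Carrier q-1
    nonzero = from ∘ punchIn (to 0#)

    from-injective : Injective _≡_ _≈_ from
    from-injective {i} {j} eq = ≡.trans (≡.sym (strictlyInverseˡ i)) (≡.trans (to-cong eq) (strictlyInverseˡ j))

    nonzero-injective : Injective _≡_ _≈_ nonzero
    nonzero-injective = Fin.punchIn-injective (to 0#) _ _ ∘ from-injective

    nonzero≉0 : ∀ i → ¬ nonzero i ≈ 0#
    nonzero≉0 i eq = Fin.punchInᵢ≢i (to 0#) i (≡.trans (≡.sym (strictlyInverseˡ _)) (to-cong eq))

    ifZero : Carrier → Carrier → Carrier → Carrier
    ifZero y a b with y ≟ 0#
    ... | yes _ = a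
    ... | no  _ = b

    ifZero-yes : ∀ {y a b} → y ≈ 0# → ifZero y a b ≈ a
    ifZero-yes {y} y≈0 with y ≟ 0#
    ... | yes _   = refl
    ... | no  y≉0 = contradiction y≈0 y≉0

    ifZero-no : ∀ {y a b} → ¬ y ≈ 0# → ifZero y a b ≈ b
    ifZero-no {y} y≉0 with y ≟ 0#
    ... | yes y≈0 = contradiction y≈0 y≉0
    ... | no  _   = refl

    -- Replacing 0 by 1 turns the product over all of F into the product over F*.
    units : Vector Carrier q
    units i = ifZero (from i) 1# (from i)

    units≉0 : ∀ i → ¬ units i ≈ 0#
    units≉0 i eq with from i ≟ 0#
    ... | yes _   = 1≉0 eq
    ... | no  y≉0 = y≉0 eq

    -- Multiplication by x permutes the field. It scales every factor in the product of `units` by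
    -- x, except the 1 standing in for zero, and the product is nonzero.
    fermat : ∀ {x} → ¬ x ≈ 0# → x ^ q-1 ≈ 1#
    fermat {x} x≉0 = *-cancelˡ (∏-≉0 units units≉0) (begin
      Π.sum units * x ^ q-1
        ≈⟨ *-congˡ x^[q-1] ⟩
      Π.sum units * Π.sum multiplier
        ≈⟨ Π.∑-distrib-+ units multiplier ⟨
      Π.sum (λ i → units i * multiplier i)
        ≈⟨ Π.sum-cong-≋ {q} scale ⟨
      Π.sum (λ i → units (to (x * from i)))
        ≈⟨ Π.sum-permute units scaling ⟨
      Π.sum units
        ≈⟨ *-identityʳ _ ⟨
      Π.sum units * 1#
        ∎)
      where
      multiplier : Vector Carrier q
      multiplier i = ifZero (from i) 1# x

      scaling : Permutation q q
      scaling = bijection⇒permutation (x *_) (inv x *_) *-congˡ *-congˡ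
        (λ y → trans (sym (*-assoc _ _ _)) (trans (*-congʳ (inv-inverseʳ x≉0)) (*-identityˡ y)))
        (λ y → trans (sym (*-assoc _ _ _)) (trans (*-congʳ (inv-inverseˡ x≉0)) (*-identityˡ y)))

      scale : ∀ i → units (to (x * from i)) ≈ units i * multiplier i
      scale i = helper (from i ≟ 0#)
        where
        x·fromᵢ = strictlyInverseʳ (x * from i)
        helper : Dec (from i ≈ 0#) → units (to (x * from i)) ≈ units i * multiplier i
        helper (yes y≈0) = begin
          units (to (x * from i))   ≈⟨ ifZero-yes (trans x·fromᵢ (trans (*-congˡ y≈0) (zeroʳ x))) ⟩
          1#                        ≈⟨ *-identityˡ 1# ⟨
          1# * 1#                   ≈⟨ *-cong (ifZero-yes y≈0) (ifZero-yes y≈0) ⟨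
          units i * multiplier i    ∎
        helper (no y≉0) = begin
          units (to (x * from i))   ≈⟨ ifZero-no (*-≉0 x≉0 y≉0 ∘ trans (sym x·fromᵢ)) ⟩
          from (to (x * from i))    ≈⟨ x·fromᵢ ⟩
          x * from i                ≈⟨ *-comm _ _ ⟩
          from i * x                ≈⟨ *-cong (ifZero-no y≉0) (ifZero-no y≉0) ⟨
          units i * multiplier i    ∎

      x^[q-1] : x ^ q-1 ≈ Π.sum multiplier
      x^[q-1] = begin
        x ^ q-1
          ≈⟨ Π.sum-replicate q-1 ⟨
        Π.sum (replicate q-1 x)
          ≈⟨ Π.sum-cong-≋ {q-1} (λ i → ifZero-no (nonzero≉0 i)) ⟨
        Π.sum (removeAt multiplier (to 0#))
          ≈⟨ *-identityˡ _ ⟨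
        1# * Π.sum (removeAt multiplier (to 0#))
          ≈⟨ *-congʳ (ifZero-yes (strictlyInverseʳ 0#)) ⟨
        multiplier (to 0#) * Π.sum (removeAt multiplier (to 0#))
          ≈⟨ Π.sum-remove multiplier ⟨
        Π.sum multiplier
          ∎

    -- A search through the nonzero elements either finds x or contradicts `powers-exhaust-roots`,
    -- since there are M (k + 1) > M k of them and all satisfy Fermat's identity.
    root-of-unity⇒power : ∀ {M k c} → 0 < M → q-1 ≡ M ℕ.* suc k → c ^ suc k ≈ 1# →
      ∃ λ x → ¬ x ≈ 0# × c ≈ x ^ M
    root-of-unity⇒power {M} {k} {c} 0<M q-1≡M[1+k] c^k≈1 with Fin.any? (λ i → (nonzero i ^ M) ≟ c)
    ... | yes (i , eq) = nonzero i , nonzero≉0 i , sym eq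
    ... | no  none     = contradiction (λ i eq → none (inject≤ i bound , eq))
      (powers-exhaust-roots 0<M c^k≈1 (λ i → nonzero (inject≤ i bound))
        (Fin.inject≤-injective _ _ _ _ ∘ nonzero-injective) λ i → begin
          (nonzero (inject≤ i bound) ^ M) ^ suc k   ≈⟨ ^-assocʳ _ M (suc k) ⟩
          nonzero (inject≤ i bound) ^ (M ℕ.* suc k) ≡⟨ ≡.cong (nonzero (inject≤ i bound) ^_) q-1≡M[1+k] ⟨
          nonzero (inject≤ i bound) ^ q-1           ≈⟨ fermat (nonzero≉0 _) ⟩
          1#                                        ∎)
      where
      bound : suc (M ℕ.* k) ≤ q-1
      bound = ≡.subst (suc (M ℕ.* k) ≤_) (≡.sym q-1≡M[1+k]) (ℕ.*-monoʳ-< M {{ℕ.>-nonZero 0<M}} (ℕ.n<1+n k))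

-- From finite Heyting fields to discrete fields.

module _ {c ℓ₁ ℓ₂} (F : HeytingField c ℓ₁ ℓ₂) {q} (card : HasCardinality F q) where
  open HeytingField F
  open HeytingCommutativeRing heytingCommutativeRing using (commutativeRing)
  open HeytingCommutativeRingProperties heytingCommutativeRing using (1#0; x-0≈x)
  open Inverse card using (to; from; to-cong; strictlyInverseʳ)

  -- Equality is decided on indices, and inverses are found by search. If the search fails, x is not
  -- apart from zero, because apartness would supply an inverse; by tightness x is then equal to
  -- zero.
  finite⇒isDiscreteField : IsDiscreteField commutativeRing
  finite⇒isDiscreteField = record { _≟_ = _≟_ ; 1≉0 = 1≉0 ; inverse = inverse }
    where
    _≟_ : Decidable _≈_
    x ≟ y with to x Fin.≟ to y
    ... | yes eq = yes (trans (sym (strictlyInverseʳ x)) (trans (reflexive (≡.cong from eq)) (strictlyInverseʳ y)))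
    ... | no neq = no (neq ∘ to-cong)

    1≉0 : ¬ 1# ≈ 0#
    1≉0 1≈0 = proj₂ (tight 1# 0#) 1≈0 1#0

    inverse : ∀ x → ¬ x ≈ 0# → ∃ λ y → y * x ≈ 1#
    inverse x x≉0 with Fin.any? (λ i → (from i * x) ≟ 1#)
    ... | yes (i , eq) = from i , eq
    ... | no  none     = contradiction (proj₁ (tight x 0#) ¬x#0) x≉0
      where
      ¬x#0 : ¬ x # 0#
      ¬x#0 x#0 with y , y[x-0]≈1 , _ ← #⇒invertible x#0 = none
        (to y , trans (*-cong (strictlyInverseʳ y) (sym (x-0≈x x))) y[x-0]≈1)

-- Arithmetic of p, d and the cofactor e.

module _ (m : ℕ) where
  open +-*-Solver
  private
    p = 3 ℕ.+ m
    M = p ℕ.^ 2 ℕ.+ p ℕ.+ 1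

  p³≡1+M[p-1] : p ℕ.^ 3 ≡ suc (M ℕ.* (2 ℕ.+ m))
  p³≡1+M[p-1] = expand m
    where
    expand : ∀ m → (3 ℕ.+ m) ℕ.^ 3 ≡ suc (((3 ℕ.+ m) ℕ.^ 2 ℕ.+ (3 ℕ.+ m) ℕ.+ 1) ℕ.* (2 ℕ.+ m))
    expand = solve 1 (λ m → (con 3 :+ m) :^ 3 :=
      con 1 :+ ((con 3 :+ m) :^ 2 :+ (con 3 :+ m) :+ con 1) :* (con 2 :+ m)) ≡.refl

  module _ (p-prime : Prime p) {d e} (e*d≡M : e ℕ.* d ≡ M) (p<d : p < d) where

    -- Otherwise e and d are both at least p + 1, but (p + 1)² = M + p exceeds M.
    e≤p : e ≤ p
    e≤p = ℕ.≮⇒≥ λ p<e → ℕ.<⇒≱ (M<[p+1]² m) (≡.subst (suc p ℕ.* suc p ≤_) e*d≡M (ℕ.*-mono-≤ p<e p<d))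
      where
      M<[p+1]² : ∀ m → (3 ℕ.+ m) ℕ.^ 2 ℕ.+ (3 ℕ.+ m) ℕ.+ 1 < (4 ℕ.+ m) ℕ.* (4 ℕ.+ m)
      M<[p+1]² m = ≡.subst (M′ <_) (expand m) (ℕ.m<m+n M′ (s≤s z≤n))
        where
        M′ = (3 ℕ.+ m) ℕ.^ 2 ℕ.+ (3 ℕ.+ m) ℕ.+ 1
        expand : ∀ m → (3 ℕ.+ m) ℕ.^ 2 ℕ.+ (3 ℕ.+ m) ℕ.+ 1 ℕ.+ (3 ℕ.+ m) ≡ (4 ℕ.+ m) ℕ.* (4 ℕ.+ m)
        expand = solve 1 (λ m → (con 3 :+ m) :^ 2 :+ (con 3 :+ m) :+ con 1 :+ (con 3 :+ m) :=
          (con 4 :+ m) :* (con 4 :+ m)) ≡.refl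

    -- M leaves remainder 1 modulo p.
    e≢p : e ≢ p
    e≢p ≡.refl = contradiction (∣1⇒≡1 (∣m+n∣m⇒∣n p∣p[1+p]+1 (divides (1 ℕ.+ p) (ℕ.*-comm p (1 ℕ.+ p))))) λ ()
      where
      expand : ∀ p → p ℕ.^ 2 ℕ.+ p ℕ.+ 1 ≡ p ℕ.* (1 ℕ.+ p) ℕ.+ 1
      expand = solve 1 (λ p → p :^ 2 :+ p :+ con 1 := p :* (con 1 :+ p) :+ con 1) ≡.refl
      p∣p[1+p]+1 : p ∣ p ℕ.* (1 ℕ.+ p) ℕ.+ 1
      p∣p[1+p]+1 = divides d (≡.trans (≡.sym (expand p)) (≡.trans (≡.sym e*d≡M) (ℕ.*-comm p d)))

    -- M = (p - 1)(p + 2) + 3, so p - 1 would divide 3. As p ≥ 3 this forces p = 4, which is not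
    -- prime.
    e≢p-1 : e ≢ 2 ℕ.+ m
    e≢p-1 ≡.refl = m-cases m p-prime (∣m+n∣m⇒∣n p-1∣ (divides (5 ℕ.+ m) (ℕ.*-comm (2 ℕ.+ m) (5 ℕ.+ m))))
      where
      expand : ∀ m → (3 ℕ.+ m) ℕ.^ 2 ℕ.+ (3 ℕ.+ m) ℕ.+ 1 ≡ (2 ℕ.+ m) ℕ.* (5 ℕ.+ m) ℕ.+ 3
      expand = solve 1 (λ m → (con 3 :+ m) :^ 2 :+ (con 3 :+ m) :+ con 1 :=
        (con 2 :+ m) :* (con 5 :+ m) :+ con 3) ≡.refl
      p-1∣ : 2 ℕ.+ m ∣ (2 ℕ.+ m) ℕ.* (5 ℕ.+ m) ℕ.+ 3
      p-1∣ = divides d (≡.trans (≡.sym (expand m)) (≡.trans (≡.sym e*d≡M) (ℕ.*-comm (2 ℕ.+ m) d)))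
      m-cases : ∀ m → Prime (3 ℕ.+ m) → ¬ 2 ℕ.+ m ∣ 3
      m-cases 0             _       = from-no (2 ∣? 3)
      m-cases 1             4-prime _ = from-no (prime? 4) 4-prime
      m-cases (suc (suc m)) _       4+m∣3 = contradiction (∣⇒≤ 4+m∣3) λ { (s≤s (s≤s (s≤s ()))) }

    e≤p-2 : e ≤ 1 ℕ.+ m
    e≤p-2 = s≤s⁻¹ (ℕ.≤∧≢⇒< (s≤s⁻¹ (ℕ.≤∧≢⇒< e≤p e≢p)) e≢p-1)

-- Cliques in the Paley graph of order p³.

module _ {c ℓ₁ ℓ₂} (F : HeytingField c ℓ₁ ℓ₂) (m : ℕ) (p-prime : Prime (3 ℕ.+ m))
  (card : HasCardinality F ((3 ℕ.+ m) ℕ.^ 3)) (d e-1 : ℕ)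
  (e*d≡M : suc e-1 ℕ.* d ≡ (3 ℕ.+ m) ℕ.^ 2 ℕ.+ (3 ℕ.+ m) ℕ.+ 1)
  where
  open HeytingField F
  open HeytingCommutativeRing heytingCommutativeRing using (commutativeRing)
  open CommutativeRing commutativeRing using (semiring; commutativeSemiring)
  open Exp commutativeSemiring
  open Mult semiring using () renaming (_×_ to _·_)
  open SetoidReasoning setoid

  private
    p = 3 ℕ.+ m
    e = suc e-1
    M = p ℕ.^ 2 ℕ.+ p ℕ.+ 1

    module K = Field commutativeRing (finite⇒isDiscreteField F card)
    module K-finite = K.Finite card

    q-1≡M[p-1] : ℕ.pred (p ℕ.^ 3) ≡ M ℕ.* (2 ℕ.+ m)
    q-1≡M[p-1] = ≡.cong ℕ.pred (p³≡1+M[p-1] m)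

    module K-char = K.Characteristic p-prime (K.[m^n]·1≈0⇒m·1≈0 p 3 K-finite.q·1≈0)

  x^M≈[x^e]^d : ∀ x → x ^ M ≈ (x ^ e) ^ d
  x^M≈[x^e]^d x = begin
    x ^ M            ≡⟨ ≡.cong (x ^_) e*d≡M ⟨
    x ^ (e ℕ.* d)    ≈⟨ ^-assocʳ x e d ⟨
    (x ^ e) ^ d      ∎

  hasClique-p : HasClique (PaleyGraph F d) p
  hasClique-p = (λ i → toℕ i · 1#) , injective , adjacent
    where
    injective : Injective _≡_ _≈_ (λ i → toℕ i · 1#)
    injective {i} {j} eq = Fin.toℕ-injective (K-char.n·1-injective (toℕ<n i) (toℕ<n j) eq)

    adjacent : ∀ {i j : Fin p} → i ≢ j → IsNonzeroPower F d (toℕ i · 1# - toℕ j · 1#)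
    adjacent {i} {j} i≢j = power (K-finite.root-of-unity⇒power {M} {1 ℕ.+ m} (s≤s z≤n) q-1≡M[p-1] v^[p-1]≈1)
      where
      v = toℕ i · 1# - toℕ j · 1#

      -- Differences of multiples of 1 are fixed by Frobenius; one factor v ≠ 0 is cancelled from vᵖ
      -- = v.
      v^[p-1]≈1 : v ^ (2 ℕ.+ m) ≈ 1#
      v^[p-1]≈1 = K.*-cancelˡ (K.x≉y⇒x-y≉0 (i≢j ∘ injective)) (begin
        v ^ p                                ≈⟨ K-char.frobenius-difference _ _ ⟩
        (toℕ i · 1#) ^ p - (toℕ j · 1#) ^ p  ≈⟨ +-cong (K-char.[n·1]^p≈n·1 (toℕ i)) (-‿cong (K-char.[n·1]^p≈n·1 (toℕ j))) ⟩
        v                                    ≈⟨ *-identityʳ v ⟨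
        v * 1#                               ∎)

      power : (∃ λ x → ¬ x ≈ 0# × v ≈ x ^ M) → IsNonzeroPower F d v
      power (x , x≉0 , v≈x^M) = x ^ e , K.^-≉0 e x≉0 , trans v≈x^M (x^M≈[x^e]^d x)

  -- If v = xᵈ, the excess factor is v to the power (p - 1) e, that is, x to the power d (p - 1) e =
  -- p³ - 1, which is 1.
  power⇒v^pe≈v^e : ∀ {v} → IsNonzeroPower F d v → (v ^ p) ^ e ≈ v ^ e
  power⇒v^pe≈v^e {v} (x , x≉0 , v≈x^d) = begin
    (v ^ p) ^ e                   ≈⟨ ^-distrib-* v (v ^ (2 ℕ.+ m)) e ⟩
    v ^ e * (v ^ (2 ℕ.+ m)) ^ e   ≈⟨ *-congˡ v^[p-1]e≈1 ⟩
    v ^ e * 1#                    ≈⟨ *-identityʳ _ ⟩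
    v ^ e                         ∎
    where
    exponent : d ℕ.* (2 ℕ.+ m) ℕ.* e ≡ ℕ.pred (p ℕ.^ 3)
    exponent = ≡.trans (swap d (2 ℕ.+ m) e) (≡.trans (≡.cong (ℕ._* (2 ℕ.+ m)) e*d≡M) (≡.sym q-1≡M[p-1]))
      where
      open +-*-Solver
      swap : ∀ d k e → d ℕ.* k ℕ.* e ≡ e ℕ.* d ℕ.* k
      swap = solve 3 (λ d k e → d :* k :* e := e :* d :* k) ≡.refl

    v^[p-1]e≈1 : (v ^ (2 ℕ.+ m)) ^ e ≈ 1#
    v^[p-1]e≈1 = begin
      (v ^ (2 ℕ.+ m)) ^ e           ≈⟨ ^-congˡ e (^-congˡ (2 ℕ.+ m) v≈x^d) ⟩
      ((x ^ d) ^ (2 ℕ.+ m)) ^ e     ≈⟨ trans (^-congˡ e (^-assocʳ x d (2 ℕ.+ m))) (^-assocʳ x (d ℕ.* (2 ℕ.+ m)) e) ⟩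
      x ^ (d ℕ.* (2 ℕ.+ m) ℕ.* e)   ≡⟨ ≡.cong (x ^_) exponent ⟩
      x ^ ℕ.pred (p ℕ.^ 3)          ≈⟨ K-finite.fermat x≉0 ⟩
      1#                            ∎

  ¬hasClique-1+p : e-1 ≤ m → ¬ HasClique (PaleyGraph F d) (suc p)
  ¬hasClique-1+p e-1≤m (a , a-inj , adjacent) =
    ¬equalPowers-frobenius e-1≤m a a-inj (λ i j → K-char.frobenius-difference (a i) (a j)) powers
    where
    open K.PowersOfDifferences e-1
      (λ k → K-char.nCk·1≉0 (s≤s⁻¹ (toℕ<n k)) (s≤s (s≤s (ℕ.m≤n⇒m≤1+n e-1≤m))))

    powers : ∀ i j → (a i ^ p - a j ^ p) ^ e ≈ (a i - a j) ^ e
    powers i j = trans (^-congˡ e (sym (K-char.frobenius-difference (a i) (a j)))) (helper (i Fin.≟ j))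
      where
      helper : Dec (i ≡ j) → ((a i - a j) ^ p) ^ e ≈ (a i - a j) ^ e
      -- Adjacency says nothing about the diagonal, where both sides are powers of zero with
      -- positive exponents.
      helper (yes ≡.refl) = ^-congˡ e (trans (^-congˡ p (-‿inverseʳ (a i))) (trans (zeroˡ _) (sym (-‿inverseʳ (a i)))))
      helper (no  i≢j)    = power⇒v^pe≈v^e (adjacent i≢j)

-- The clique number.

open import Data.Nat.Base using (_+_; _^_)

theorem1p5 : ∀ {c ℓ₁ ℓ₂} (p d : ℕ) → Prime p → ¬ (2 ∣ p) →
    d ∣ p ^ 2 + p + 1 → p < d →
    (F : HeytingField c ℓ₁ ℓ₂) → HasCardinality F (p ^ 3) →
    CliqueNumberIs (PaleyGraph F d) p
theorem1p5 0 d 0-prime _ _ _ _ _ = contradiction 0-prime ¬prime[0]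
theorem1p5 1 d 1-prime _ _ _ _ _ = contradiction 1-prime ¬prime[1]
theorem1p5 2 d _ 2∤2 _ _ _ _ = contradiction (divides 1 ≡.refl) 2∤2
theorem1p5 (suc (suc (suc m))) d p-prime _ (divides zero    ()) p<d F card
theorem1p5 (suc (suc (suc m))) d p-prime _ (divides (suc e-1) M≡e*d) p<d F card =
  hasClique-p F m p-prime card d e-1 (≡.sym M≡e*d) , λ n (a , a-inj , adjacent) → ℕ.≮⇒≥ λ p<n →
    ¬hasClique-1+p F m p-prime card d e-1 (≡.sym M≡e*d)
      (s≤s⁻¹ (e≤p-2 m p-prime (≡.sym M≡e*d) p<d))
      -- The first p + 1 points of a larger clique already form a clique.
      ( (λ i → a (inject≤ i p<n))
      , Fin.inject≤-injective _ _ _ _ ∘ a-inj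
      , λ i≢j → adjacent (i≢j ∘ Fin.inject≤-injective _ _ _ _))
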